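{- For every positive integer $k$, there is a graph $G$ with fusion-width $\mathrm{fw}(G)=k$ and clique-width $\mathrm{cw}(G)\ge 2^{\lfloor k/2\rfloor-2}$.
   Context: Graphs are finite, simple, undirected and nonempty. A $k$-expression is an expression built from atoms $i(v)$, unary operations $\eta_{i,j}$ and $\rho_{i\to j}$, and the binary operation $\oplus$, with labels $i,j\in\{1,\dots,k\}$, where: $i(v)$ creates a single vertex $v$ with label $i$; $\eta_{i,j}$ (for $i\neq j$) creates an edge between every vertex with label $i$ and every vertex with label $j$; $\rho_{i\to j}$ changes all labels $i$ to $j$; $\oplus$ forms the disjoint union of two labeled graphs. The generated graph is obtained by finally deleting the labels. The clique-width $\mathrm{cw}(G)$ is the smallest $k$ such that $G$ is generated by a $k$-expression. A $k$-fusion-tree expression is an expression built from atoms $i\langle m\rangle$, unary operations $\eta_{i,j}$, $\rho_{i\to j}$, $\theta_i$, and the binary operation $\oplus$, with labels $i,j\in\{1,\dots,k\}$, where: $i\langle m\rangle$ creates a graph consisting of $m$ isolated vertices labeled $i$; $\eta_{i,j}$ (for $i\ne j$) creates an edge between every vertex with label $i$ and every vertex with label $j$; $\rho_{i\to j}$ changes all labels $i$ to $j$; $\oplus$ forms the disjoint union of two labeled graphs; $\theta_i$ merges all vertices labeled $i$ into one vertex, which is labeled $i$ and is adjacent to every vertex not labeled $i$ to which some vertex labeled $i$ was adjacent before the operation. The generated graph is obtained by finally deleting all labels. The fusion-width $\mathrm{fw}(G)$ is the smallest $k$ such that there is a $k$-fusion-tree expression generating $G$. -}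

module Defs where

open import Data.Bool using (if_then_else_)
open import Data.Empty using (⊥)
open import Data.Fin using (Fin)
open import Data.Fin.Properties using (_≟_)
open import Data.Nat using (ℕ; NonZero; _≤_; _*_)
open import Data.Nat.Properties using (≤-trans; *-monoˡ-≤)
open import Data.Product using (Σ; _×_; _,_; ∃-syntax)
open import Data.Sum using (_⊎_; [_,_]′)
open import Data.Sum.Relation.Binary.Pointwise using (Pointwise)
open import Function.Bundles using (_↔_; _⇔_; mk⇔; Inverse)
open import Level using (0ℓ)
open import Relation.Binary using (Rel; Decidable; Symmetric; Irreflexive)
open import Relation.Binary.PropositionalEquality using (_≡_; _≢_)
open import Relation.Nullary.Decidable using (⌊_⌋)

record Graph : Set₁ where
  field
    order      : ℕ
    {{nonEmpty}} : NonZero order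
    Adj        : Rel (Fin order) 0ℓ
    adj?       : Decidable Adj
    adj-sym    : Symmetric Adj
    adj-irrefl : Irreflexive _≡_ Adj

record LabelledGraph (k : ℕ) : Set₁ where
  field
    Vertex : Set
    label  : Vertex → Fin k
    Edge   : Rel Vertex 0ℓ

open LabelledGraph

module _ {k : ℕ} where

  isolated : Fin k → ℕ → LabelledGraph k
  isolated i m = record
    { Vertex = Fin m
    ; label  = λ _ → i
    ; Edge   = λ _ _ → ⊥
    }

  join : Fin k → Fin k → LabelledGraph k → LabelledGraph k
  join i j H = record
    { Vertex = Vertex H
    ; label  = label H
    ; Edge   = λ u v → Edge H u v
                     ⊎ (label H u ≡ i × label H v ≡ j)
                     ⊎ (label H u ≡ j × label H v ≡ i)
    }

  relabel : Fin k → Fin k → LabelledGraph k → LabelledGraph k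
  relabel i j H = record
    { Vertex = Vertex H
    ; label  = λ v → if ⌊ label H v ≟ i ⌋ then j else label H v
    ; Edge   = Edge H
    }

  union : LabelledGraph k → LabelledGraph k → LabelledGraph k
  union H K = record
    { Vertex = Vertex H ⊎ Vertex K
    ; label  = [ label H , label K ]′
    ; Edge   = Pointwise (Edge H) (Edge K)
    }

  -- The irrelevant arguments make all the proofs below equal, so there is
  -- at most one merged vertex, and there is none if no vertex of H has
  -- label i (in which case merging leaves H unchanged up to isomorphism).
  data FusedVertex (i : Fin k) (H : LabelledGraph k) : Set where
    kept   : (v : Vertex H) → .(label H v ≢ i) → FusedVertex i H
    merged : .(∃[ v ] label H v ≡ i) → FusedVertex i H

  module _ (i : Fin k) (H : LabelledGraph k) where

    fusedLabel : FusedVertex i H → Fin k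
    fusedLabel (kept v _) = label H v
    fusedLabel (merged _) = i

    -- An edge joining two vertices of label i does not become a loop.
    FusedEdge : Rel (FusedVertex i H) 0ℓ
    FusedEdge (kept u _) (kept v _) = Edge H u v
    FusedEdge (kept u _) (merged _) = ∃[ w ] (label H w ≡ i × Edge H u w)
    FusedEdge (merged _) (kept v _) = ∃[ w ] (label H w ≡ i × Edge H w v)
    FusedEdge (merged _) (merged _) = ⊥

    fuse : LabelledGraph k
    fuse = record
      { Vertex = FusedVertex i H
      ; label  = fusedLabel
      ; Edge   = FusedEdge
      }

-- Graphs are considered up to isomorphism, so the atom i(v) does not record
-- the name v of the vertex it creates.
data CliqueExpr (k : ℕ) : Set where
  atom : (i : Fin k) → CliqueExpr k
  η    : (i j : Fin k) → i ≢ j → CliqueExpr k → CliqueExpr k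
  ρ    : (i j : Fin k) → CliqueExpr k → CliqueExpr k
  _⊕_  : CliqueExpr k → CliqueExpr k → CliqueExpr k

-- Every graph is nonempty, hence so is every atom i⟨m⟩.
data FusionExpr (k : ℕ) : Set where
  atom : (i : Fin k) (m : ℕ) .{{_ : NonZero m}} → FusionExpr k
  η    : (i j : Fin k) → i ≢ j → FusionExpr k → FusionExpr k
  ρ    : (i j : Fin k) → FusionExpr k → FusionExpr k
  θ    : (i : Fin k) → FusionExpr k → FusionExpr k
  _⊕_  : FusionExpr k → FusionExpr k → FusionExpr k

evalClique : ∀ {k} → CliqueExpr k → LabelledGraph k
evalClique (atom i)    = isolated i 1
evalClique (η i j _ e) = join i j (evalClique e)
evalClique (ρ i j e)   = relabel i j (evalClique e)
evalClique (e ⊕ f)     = union (evalClique e) (evalClique f)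

evalFusion : ∀ {k} → FusionExpr k → LabelledGraph k
evalFusion (atom i m)  = isolated i m
evalFusion (η i j _ e) = join i j (evalFusion e)
evalFusion (ρ i j e)   = relabel i j (evalFusion e)
evalFusion (θ i e)     = fuse i (evalFusion e)
evalFusion (e ⊕ f)     = union (evalFusion e) (evalFusion f)

-- Isomorphism with the underlying unlabelled graph.
_Generates_ : ∀ {k} → LabelledGraph k → Graph → Set
H Generates G = Σ (Vertex H ↔ Fin order) λ φ →
    ∀ u v → Edge H u v ⇔ Adj (Inverse.to φ u) (Inverse.to φ v)
  where open Graph G

CliqueGenerated : Graph → ℕ → Set
CliqueGenerated G k = Σ (CliqueExpr k) λ e → evalClique e Generates G

FusionGenerated : Graph → ℕ → Set
FusionGenerated G k = Σ (FusionExpr k) λ e → evalFusion e Generates G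

IsLeast : (ℕ → Set) → ℕ → Set
IsLeast P n = P n × (∀ m → P m → n ≤ m)

HasFusionWidth : Graph → ℕ → Set
HasFusionWidth G = IsLeast (FusionGenerated G)

HasCliqueWidth : Graph → ℕ → Set
HasCliqueWidth G = IsLeast (CliqueGenerated G)

-- cw(G) · d ≥ b, where the factor d clears the denominator of a rational
-- bound b / d.  A bound on the least c with CliqueGenerated G c is a bound on
-- all such c; in this form it needs no decision procedure to find the least.
CliqueWidth_·_≥_ : Graph → ℕ → ℕ → Set
CliqueWidth G · d ≥ b = ∀ c → CliqueGenerated G c → b ≤ c * d

cw-bound : ∀ {G c} d {b} → HasCliqueWidth G c →
           CliqueWidth G · d ≥ b ⇔ b ≤ c * d
cw-bound {c = c} d (gen , least) = mk⇔
  (λ bound → bound c gen)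
  (λ b≤cd m gen′ → ≤-trans b≤cd (*-monoˡ-≤ d (least m gen′)))

{-# OPTIONS --safe #-}
-- Let X(e) be the set of final vertices that have a preimage in a subexpression
-- e. Vertices with the same label in e receive the same edges from then on,
-- unless they are fused, so the number of labels is at least the number of
-- pairwise distinguishable vertices of X(e).
--
-- With S slots for hubs, a tree of hubs is built from S + 1 labels: one for each
-- open hub and one for all finished vertices; copies of an open hub are fused at
-- every union.
--
-- Fusion-width from below: in a binary tree of hubs over stars, consider a lowest
-- union e that contains a whole star. Each hub above this star accounts for one
-- distinguishable vertex of X(e): the hub itself, a leaf of the star attached to
-- it, or a vertex in the other subtree of the hub. The centre of the star and a
-- free leaf account for two more.
--
-- Clique-width from below: now the two sides of a union are disjoint. Let 2τ hubs
-- be fixed. A set that realises all subsets of them as neighbourhoods and misses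
-- τ of them needs 2^τ labels, so with fewer labels no two disjoint sets realise
-- all subsets. The subexpressions that do form a chain, along which a ternary
-- tree of height j has j + 1 independent cut edges at some time, as for pathwidth.

module Submission where

open import Defs
open import Data.Bool using (Bool; true; false; not; _∧_; _∨_; if_then_else_)
import Data.Bool.Properties as Bool
open import Data.Empty using (⊥; ⊥-elim)
import Data.Empty.Irrelevant as Irrelevant
open import Data.Fin using (Fin; zero; suc; combine; remQuot)
open import Data.Fin.Properties using (_≟_; suc-injective; any?; all?; +↔⊎; 1↔⊤; injective⇒≤; combine-remQuot)
open import Data.Fin.Subset using (∣_∣)
open import Data.Fin.Subset.Properties using (anySubset?)
open import Data.List using (List; []; _∷_; foldr; allFin; length)
open import Data.List.Membership.Propositional using (_∈_)
open import Data.List.Membership.Propositional.Properties using (∈-allFin)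
open import Data.List.Properties using (length-tabulate)
open import Data.List.Relation.Unary.All as All using ([]; _∷_)
open import Data.List.Relation.Unary.AllPairs using ([]; _∷_)
open import Data.List.Relation.Unary.Any using (here; there)
open import Data.List.Relation.Unary.Unique.Propositional using (Unique)
open import Data.List.Relation.Unary.Unique.Propositional.Properties using (allFin⁺)
open import Data.Nat using (ℕ; zero; suc; _+_; _*_; _≤_; _^_; ⌊_/2⌋; NonZero; z≤n; s≤s; _≤?_)
open import Data.Nat.Properties using (≤-trans; ≤-reflexive; ≤-total; ≰⇒>; <⇒≱; n≤1+n; m≤n⇒m<n∨m≡n; +-suc; +-mono-<; +-monoʳ-≤; *-assoc; *-comm; *-monoˡ-≤; ^-monoʳ-≤; ⌊n/2⌋≤⌈n/2⌉; ⌊n/2⌋+⌈n/2⌉≡n)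
open import Data.Product using (Σ; _×_; _,_; ∃-syntax; proj₁; proj₂)
open import Data.Sum using (_⊎_; inj₁; inj₂; [_,_]′; swap)
open import Data.Sum.Function.Propositional using (_⊎-↔_)
import Data.Sum.Properties as Sum
open import Data.Sum.Properties using (inj₁-injective; inj₂-injective)
open import Data.Sum.Relation.Binary.Pointwise using (Pointwise; inj₁; inj₂)
open import Data.Unit using (⊤; tt)
open import Data.Vec using (Vec; []; _∷_; lookup; tabulate; replicate)
open import Data.Vec.Properties using (lookup∘tabulate; lookup-replicate; ∷-injective)
open import Function using (_∘_; id; case_of_)
open import Function.Bundles using (_↔_; Inverse; mk↔ₛ′; Equivalence; mk⇔)
open import Function.Construct.Composition using (_↔-∘_)
open import Function.Construct.Identity using (↔-id)
open import Function.Construct.Symmetry using (↔-sym)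
open import Relation.Binary using (DecidableEquality)
open import Relation.Binary.PropositionalEquality using (_≡_; _≢_; refl; sym; trans; cong; cong₂; subst; ≢-sym)
open import Relation.Nullary using (Dec; yes; no; does; ¬_; contradiction)
open import Relation.Nullary.Decidable using (⌊_⌋; dec-true; dec-false; map′; ¬?; decidable-stable; _×-dec_)

open LabelledGraph

-- Terms and their graphs

-- Graphs whose vertices are attached to some of S slots: close σ adds a hub,
-- joins it to all vertices attached to the slot σ, and frees the slot.
data Term (S : ℕ) : Set where
  leaf  : Vec Bool S → Term S
  _∥_   : Term S → Term S → Term S
  close : Fin S → Term S → Term S

infixr 5 _∥_

pattern hub   = inj₁ tt
pattern old v = inj₂ v

V : ∀ {S} → Term S → Set
V (leaf _)    = ⊤
V (s ∥ t)     = V s ⊎ V t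
V (close _ t) = ⊤ ⊎ V t

port : ∀ {S} (t : Term S) → V t → Fin S → Bool
port (leaf p)    _        i = lookup p i
port (s ∥ t)     (inj₁ v) i = port s v i
port (s ∥ t)     (inj₂ v) i = port t v i
port (close σ t) hub      i = false
port (close σ t) (old v)  i = not (does (i ≟ σ)) ∧ port t v i

adj : ∀ {S} (t : Term S) → V t → V t → Bool
adj (leaf _)    _        _        = false
adj (s ∥ t)     (inj₁ u) (inj₁ v) = adj s u v
adj (s ∥ t)     (inj₁ _) (inj₂ _) = false
adj (s ∥ t)     (inj₂ _) (inj₁ _) = false
adj (s ∥ t)     (inj₂ u) (inj₂ v) = adj t u v
adj (close σ t) hub      hub      = false
adj (close σ t) hub      (old v)  = port t v σ
adj (close σ t) (old v)  hub      = port t v σ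
adj (close σ t) (old u)  (old v)  = adj t u v

adj-sym : ∀ {S} (t : Term S) u v → adj t u v ≡ adj t v u
adj-sym (leaf _)    _        _        = refl
adj-sym (s ∥ t)     (inj₁ u) (inj₁ v) = adj-sym s u v
adj-sym (s ∥ t)     (inj₁ _) (inj₂ _) = refl
adj-sym (s ∥ t)     (inj₂ _) (inj₁ _) = refl
adj-sym (s ∥ t)     (inj₂ u) (inj₂ v) = adj-sym t u v
adj-sym (close σ t) hub      hub      = refl
adj-sym (close σ t) hub      (old v)  = refl
adj-sym (close σ t) (old v)  hub      = refl
adj-sym (close σ t) (old u)  (old v)  = adj-sym t u v

adj-irrefl : ∀ {S} (t : Term S) v → adj t v v ≡ false
adj-irrefl (leaf _)    _        = refl
adj-irrefl (s ∥ t)     (inj₁ u) = adj-irrefl s u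
adj-irrefl (s ∥ t)     (inj₂ u) = adj-irrefl t u
adj-irrefl (close σ t) hub      = refl
adj-irrefl (close σ t) (old u)  = adj-irrefl t u

port-other : ∀ {S} (σ : Fin S) t v {i} → i ≢ σ → port (close σ t) (old v) i ≡ port t v i
port-other σ t v {i} i≢σ rewrite dec-false (i ≟ σ) i≢σ = refl

port-closed : ∀ {S} (σ : Fin S) t v → port (close σ t) v σ ≡ false
port-closed σ t hub     = refl
port-closed σ t (old v) rewrite dec-true (σ ≟ σ) refl = refl

false≢true : false ≢ true
false≢true ()

≡true? : ∀ b → Dec (b ≡ true)
≡true? b = b Bool.≟ true

-- In the graph of a term, every slot is occupied by a hub of its own.
withHubs : ∀ {j} {A : Set} → (A → Fin j → Bool) → (A → A → Bool) →
           Fin j ⊎ A → Fin j ⊎ A → Bool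
withHubs p e (inj₁ i) (inj₁ j) = false
withHubs p e (inj₁ i) (inj₂ v) = p v i
withHubs p e (inj₂ v) (inj₁ i) = p v i
withHubs p e (inj₂ u) (inj₂ v) = e u v

withHubs-sym : ∀ {j} {A : Set} {p : A → Fin j → Bool} {e : A → A → Bool} →
               (∀ u v → e u v ≡ e v u) → ∀ u v → withHubs p e u v ≡ withHubs p e v u
withHubs-sym e-sym (inj₁ i) (inj₁ j) = refl
withHubs-sym e-sym (inj₁ i) (inj₂ v) = refl
withHubs-sym e-sym (inj₂ v) (inj₁ i) = refl
withHubs-sym e-sym (inj₂ u) (inj₂ v) = e-sym u v

V⁺ : ∀ {S} → Term S → Set
V⁺ {S} t = Fin S ⊎ V t

adj⁺ : ∀ {S} (t : Term S) → V⁺ t → V⁺ t → Bool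
adj⁺ t = withHubs (port t) (adj t)

adj⁺-sym : ∀ {S} (t : Term S) u v → adj⁺ t u v ≡ adj⁺ t v u
adj⁺-sym t = withHubs-sym (adj-sym t)

adj⁺-irrefl : ∀ {S} (t : Term S) v → adj⁺ t v v ≡ false
adj⁺-irrefl t (inj₁ i) = refl
adj⁺-irrefl t (inj₂ v) = adj-irrefl t v

size : ∀ {S} → Term S → ℕ
size (leaf _)    = 1
size (s ∥ t)     = size s + size t
size (close _ t) = 1 + size t

V↔Fin : ∀ {S} (t : Term S) → V t ↔ Fin (size t)
V↔Fin (leaf _)    = ↔-sym 1↔⊤
V↔Fin (s ∥ t)     = ↔-sym +↔⊎ ↔-∘ (V↔Fin s ⊎-↔ V↔Fin t)
V↔Fin (close _ t) = ↔-sym +↔⊎ ↔-∘ (↔-sym 1↔⊤ ⊎-↔ V↔Fin t)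

size-nonZero : ∀ {S} (t : Term S) → NonZero (size t)
size-nonZero (leaf _)    = _
size-nonZero (s ∥ t)     with size s | size-nonZero s
... | suc _ | _ = _
size-nonZero (close _ t) = _

V⁺↔Fin : ∀ {S} (t : Term S) → V⁺ t ↔ Fin (S + size t)
V⁺↔Fin t = ↔-sym +↔⊎ ↔-∘ (↔-id _ ⊎-↔ V↔Fin t)

graph : ∀ {S} → Term S → Graph
graph {S} t = record
  { order      = S + size t
  ; nonEmpty   = nonZero S
  ; Adj        = λ x y → adj⁺ t (vertex x) (vertex y) ≡ true
  ; adj?       = λ x y → ≡true? _
  ; adj-sym    = λ {x} {y} e → trans (adj⁺-sym t (vertex y) (vertex x)) e
  ; adj-irrefl = λ { {x} refl e → false≢true (trans (sym (adj⁺-irrefl t (vertex x))) e) }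
  }
  where
  vertex = Inverse.from (V⁺↔Fin t)
  nonZero : ∀ m → NonZero (m + size t)
  nonZero zero    = size-nonZero t
  nonZero (suc m) = _

-- Decidable equality and exhaustive search

≟-V : ∀ {S} (t : Term S) → DecidableEquality (V t)
≟-V (leaf _)    tt tt = yes refl
≟-V (s ∥ t)     = Sum.≡-dec (≟-V s) (≟-V t)
≟-V (close _ t) = Sum.≡-dec (λ { tt tt → yes refl }) (≟-V t)

≟-V⁺ : ∀ {S} (t : Term S) → DecidableEquality (V⁺ t)
≟-V⁺ t = Sum.≡-dec _≟_ (≟-V t)

-- Finiteness in a form that sums and fusion preserve without any count of vertices. It makes
-- membership in the vertex set of a subexpression decidable.
Searchable : Set → Set₁
Searchable A = ∀ {Q : A → Set} → (∀ a → Dec (Q a)) → Dec (∃[ a ] Q a)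

search-⊤ : Searchable ⊤
search-⊤ Q? = map′ (tt ,_) proj₂ (Q? tt)

search-⊎ : ∀ {A B} → Searchable A → Searchable B → Searchable (A ⊎ B)
search-⊎ sA sB Q? with sA (Q? ∘ inj₁) | sB (Q? ∘ inj₂)
... | yes (a , q) | _           = yes (inj₁ a , q)
... | no _        | yes (b , q) = yes (inj₂ b , q)
... | no ¬a       | no ¬b       = no λ { (inj₁ a , q) → ¬a (a , q) ; (inj₂ b , q) → ¬b (b , q) }

search-V : ∀ {S} (t : Term S) → Searchable (V t)
search-V (leaf _)    = search-⊤
search-V (s ∥ t)     = search-⊎ (search-V s) (search-V t)
search-V (close _ t) = search-⊎ search-⊤ (search-V t)

all-or-counterexample : ∀ {S} (t : Term S) (X : V t → Bool) →
                        (∀ v → X v ≡ true) ⊎ (∃[ v ] X v ≡ false)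
all-or-counterexample t X with search-V t (λ v → X v Bool.≟ false)
... | yes ce = inj₂ ce
... | no ¬ce = inj₁ λ v → Bool.¬-not λ e → ¬ce (v , e)

-- Paths, embeddings, cut edges and systems of independent edges

data Path {S} (t : Term S) : V t → V t → Set where
  []  : ∀ {u} → Path t u u
  _∷_ : ∀ {u v w} → adj t u v ≡ true → Path t v w → Path t u w

_++ᴾ_ : ∀ {S} {t : Term S} {u v w} → Path t u v → Path t v w → Path t u w
[]      ++ᴾ q = q
(e ∷ p) ++ᴾ q = e ∷ (p ++ᴾ q)

reverse : ∀ {S} {t : Term S} {u v} → Path t u v → Path t v u
reverse []                        = []
reverse {t = t} (_∷_ {u} {v} e p) = reverse p ++ᴾ (trans (adj-sym t v u) e ∷ [])

-- Only adjacency is compared, since closing a slot outside `s` changes ports; `Keeps` adds the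
-- ports of the fixed slots where these matter.
record _↪_ {S} (s t : Term S) : Set where
  field
    to      : V s → V t
    adj-to  : ∀ u v → adj t (to u) (to v) ≡ adj s u v

open _↪_

↪-refl : ∀ {S} {t : Term S} → t ↪ t
↪-refl = record { to = id ; adj-to = λ _ _ → refl }

map-path : ∀ {S} {s t : Term S} (f : s ↪ t) {u v} → Path s u v → Path t (to f u) (to f v)
map-path f []      = []
map-path f (e ∷ p) = trans (adj-to f _ _) e ∷ map-path f p

inˡ : ∀ {S} {s t : Term S} → s ↪ (s ∥ t)
inˡ = record { to = inj₁ ; adj-to = λ _ _ → refl }

inʳ : ∀ {S} {s t : Term S} → t ↪ (s ∥ t)
inʳ = record { to = inj₂ ; adj-to = λ _ _ → refl }

inᶜ : ∀ {S} {σ} {t : Term S} → t ↪ close σ t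
inᶜ = record { to = inj₂ ; adj-to = λ _ _ → refl }

infixr 9 _∘↪_
_∘↪_ : ∀ {S} {r s t : Term S} → s ↪ t → r ↪ s → r ↪ t
g ∘↪ f = record
  { to     = to g ∘ to f
  ; adj-to = λ u v → trans (adj-to g _ _) (adj-to f u v)
  }

closeˡ : ∀ {S} {σ} {s t : Term S} → close σ s ↪ close σ (s ∥ t)
closeˡ = record
  { to     = λ { hub → hub ; (old v) → old (inj₁ v) }
  ; adj-to = λ { hub hub → refl ; hub (old _) → refl ; (old _) hub → refl ; (old _) (old _) → refl }
  }

closeʳ : ∀ {S} {σ} {s t : Term S} → close σ t ↪ close σ (s ∥ t)
closeʳ = record
  { to     = λ { hub → hub ; (old v) → old (inj₂ v) }
  ; adj-to = λ { hub hub → refl ; hub (old _) → refl ; (old _) hub → refl ; (old _) (old _) → refl }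
  }

CutEdge : ∀ {S} (t : Term S) → (V t → Bool) → Set
CutEdge t X = ∃[ r ] ∃[ z ] (X r ≡ true × X z ≡ false × adj t r z ≡ true)

cut-edge : ∀ {S} {t : Term S} (X : V t → Bool) {u v} → Path t u v →
           X u ≡ true → X v ≡ false → CutEdge t X
cut-edge X []                  xu xv = contradiction (trans (sym xv) xu) false≢true
cut-edge X (_∷_ {v = w} e p) xu xv with X w in xw
... | true  = cut-edge X p xw xv
... | false = _ , w , xu , xw , e

Connected : ∀ {S} → Term S → Set
Connected t = ∀ u v → Path t u v

-- The form of connectedness that survives `_∥_`: a union falls apart until a hub is closed over it,
-- so the paths are taken in the closed term and end at its hub.
Linked : ∀ {S} → Fin S → Term S → Set
Linked σ t = ∀ v → Path (close σ t) (old v) hub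

linked-∥ : ∀ {S} {σ : Fin S} {s t} → Linked σ s → Linked σ t → Linked σ (s ∥ t)
linked-∥ ls lt (inj₁ v) = map-path closeˡ (ls v)
linked-∥ ls lt (inj₂ v) = map-path closeʳ (lt v)

connected⇒linked : ∀ {S} {σ : Fin S} {t} → Connected t →
                   (∃[ v ] port t v σ ≡ true) → Linked σ t
connected⇒linked c (p , pσ) v = map-path inᶜ (c v p) ++ᴾ (pσ ∷ [])

linked⇒connected : ∀ {S} {σ : Fin S} {t} → Linked σ t → Connected (close σ t)
linked⇒connected l u v = path u ++ᴾ reverse (path v)
  where
  path : ∀ v → Path _ v hub
  path hub     = []
  path (old v) = l v

-- Edges r i — z i forming an induced matching up to orientation: no r i ~ z j
-- and r j ~ z i hold together.
record System {S} (t : Term S) (A : V t → V t → Set) (m : ℕ) : Set where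
  field
    r z    : Fin m → V t
    anchor : ∀ i → A (r i) (z i)
    edge   : ∀ i → adj t (r i) (z i) ≡ true
    indep  : ∀ {i j} → i ≢ j → adj t (r i) (z j) ≡ true → adj t (r j) (z i) ≡ true → ⊥

open System

no-system : ∀ {S} {t : Term S} {A} → System t A 0
no-system = record { r = λ () ; z = λ () ; anchor = λ () ; edge = λ () ; indep = λ { {()} } }

map-system : ∀ {S} {s t : Term S} {A B m} (f : s ↪ t) → (∀ {u v} → A u v → B (to f u) (to f v)) →
             System s A m → System t B m
map-system f h s = record
  { r      = to f ∘ r s
  ; z      = to f ∘ z s
  ; anchor = λ i → h (anchor s i)
  ; edge   = λ i → trans (adj-to f _ _) (edge s i)
  ; indep  = λ i≢j e e′ → indep s i≢j (trans (sym (adj-to f _ _)) e) (trans (sym (adj-to f _ _)) e′)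
  }

extend : ∀ {S} {t : Term S} {A m} (s : System t A m) r₀ z₀ → A r₀ z₀ → adj t r₀ z₀ ≡ true →
         (∀ i → adj t r₀ (z s i) ≡ true → adj t (r s i) z₀ ≡ true → ⊥) → System t A (suc m)
extend s r₀ z₀ a e ind = record
  { r      = λ { zero → r₀ ; (suc i) → r s i }
  ; z      = λ { zero → z₀ ; (suc i) → z s i }
  ; anchor = λ { zero → a ; (suc i) → anchor s i }
  ; edge   = λ { zero → e ; (suc i) → edge s i }
  ; indep  = λ { {zero}  {zero}  0≢0 → contradiction refl 0≢0
               ; {zero}  {suc j} _ → ind j
               ; {suc i} {zero}  _ e₁ e₂ → ind i e₂ e₁
               ; {suc i} {suc j} i≢j → indep s (i≢j ∘ cong suc) }
  }

-- Subexpressions seen from the finished graph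

module _ {W : Set} (_≟ᵂ_ : DecidableEquality W) (_~_ : W → W → Set) where

  Joined : ∀ {k} (H : LabelledGraph k) (π : Vertex H → W) → W → W → Set
  Joined H π a b = ∃[ u ] ∃[ v ] (π u ≡ a × π v ≡ b × Edge H u v)

  -- H is the graph of a subexpression of an expression for (W, _~_), where π v
  -- is the final vertex that v becomes. Vertices of equal label keep receiving
  -- the same edges, unless they are fused.
  record Future {k} (H : LabelledGraph k) (π : Vertex H → W) : Set where
    field
      later : ∀ {u w z} → label H u ≡ label H w → π u ~ z → Joined H π (π u) z ⊎ π w ~ z
      alone : ∀ {u w u′} → label H u ≡ label H w → π u ≢ π w → π u′ ≡ π u → u′ ≡ u
      sound : ∀ {u w} → Edge H u w → π u ~ π w ⊎ π u ≡ π w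

  open Future

  module _ {k} {H : LabelledGraph k} where

    -- By `alone`, an edge that this join adds at a copy of `π u` is added at `u` itself, hence also
    -- at `w`, which has the same label. By `sound` it becomes an adjacency of final vertices unless
    -- it collapses. A collapse would make its other end a copy of `π w`, which is `w` by `alone`;
    -- but the two ends have the different labels `i` and `j`.
    future-join : ∀ {i j π} → i ≢ j → Future (join i j H) π → Future H π
    future-join {i} {j} {π} i≢j F = record
      { later = later′
      ; alone = alone F
      ; sound = sound F ∘ inj₁
      }
      where
      new : ∀ {u w z′} {z} → label H u ≡ label H w → π u ≢ π w → π z′ ≡ z → label H z′ ≢ label H w →
            Edge (join i j H) w z′ → π w ~ z
      new l πu≢πw refl l≢ e with sound F e
      ... | inj₁ a    = a
      ... | inj₂ πw≡z = contradiction (cong (label H) (alone F (sym l) (≢-sym πu≢πw) (sym πw≡z))) l≢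
      later′ : ∀ {u w z} → label H u ≡ label H w → π u ~ z → Joined H π (π u) z ⊎ π w ~ z
      later′ {u} {w} {z} l a with π u ≟ᵂ π w
      ... | yes πu≡πw = inj₂ (subst (_~ z) πu≡πw a)
      ... | no πu≢πw with later F l a
      ...   | inj₂ a′ = inj₂ a′
      ...   | inj₁ (u′ , z′ , eu , ez , inj₁ e) = inj₁ (u′ , z′ , eu , ez , e)
      ...   | inj₁ (u′ , z′ , eu , ez , inj₂ (inj₁ (lu , lz))) with refl ← alone F l πu≢πw eu =
              inj₂ (new l πu≢πw ez (λ e → i≢j (trans (sym lu) (trans l (trans (sym e) lz))))
                (inj₂ (inj₁ (trans (sym l) lu , lz))))
      ...   | inj₁ (u′ , z′ , eu , ez , inj₂ (inj₂ (lu , lz))) with refl ← alone F l πu≢πw eu =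
              inj₂ (new l πu≢πw ez (λ e → i≢j (trans (sym lz) (trans e (trans (sym l) lu))))
                (inj₂ (inj₂ (trans (sym l) lu , lz))))

    future-relabel : ∀ {i j π} → Future (relabel i j H) π → Future H π
    future-relabel {i} {j} F = record
      { later = λ l → later F (cong new l)
      ; alone = λ l → alone F (cong new l)
      ; sound = sound F
      }
      where
      new : Fin k → Fin k
      new l = if ⌊ l ≟ i ⌋ then j else l

    -- Vertices of equal label with different images cannot have label `i`, so both are kept, and
    -- the merged vertex occurs only as the other end of an edge. Its origin is hidden behind an
    -- irrelevant proof, so `preimage` recovers a vertex by search.
    future-fuse : ∀ {i π} → Searchable (Vertex H) → Future (fuse i H) π →
                  Σ (Vertex H → W) λ π′ → Future H π′ × (∀ u → ∃[ v ] π′ v ≡ π u)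
    future-fuse {i} {π} search F = π′ , F′ , preimage
      where
      fv′ : (v : Vertex H) → Dec (label H v ≡ i) → FusedVertex i H
      fv′ v (yes e) = merged (v , e)
      fv′ v (no ¬e) = kept v ¬e
      fv : Vertex H → FusedVertex i H
      fv v = fv′ v (label H v ≟ i)
      π′ : Vertex H → W
      π′ = π ∘ fv
      fv-kept : ∀ v .p → fv v ≡ kept v p
      fv-kept v p with label H v ≟ i
      ... | yes l = Irrelevant.⊥-elim (p l)
      ... | no _  = refl
      fv-merged : ∀ {v} (l : label H v ≡ i) → fv v ≡ merged (v , l)
      fv-merged {v} l with label H v ≟ i
      ... | yes _ = refl
      ... | no ¬l = contradiction l ¬l
      on-kept : ∀ v .p → π′ v ≡ π (kept v p)
      on-kept v p = cong π (fv-kept v p)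
      on-merged : ∀ {v} (l : label H v ≡ i) → π′ v ≡ π (merged (v , l))
      on-merged l = cong π (fv-merged l)
      preimage : ∀ u → ∃[ v ] π′ v ≡ π u
      preimage (kept v p) = v , on-kept v p
      preimage (merged p) with search (λ v → label H v ≟ i)
      ... | yes (v , l) = v , on-merged l
      ... | no none     = Irrelevant.⊥-elim (none p)
      both : ∀ {u w} → label H u ≡ label H w → π′ u ≢ π′ w →
             Σ (label H u ≢ i) λ p → Σ (label H w ≢ i) λ p′ → fv u ≡ kept u p × fv w ≡ kept w p′
      both {u} {w} l ne with label H u ≟ i | label H w ≟ i
      ... | yes a | yes b = contradiction refl ne
      ... | yes a | no b  = contradiction (trans (sym l) a) b
      ... | no a  | yes b = contradiction (trans l b) a
      ... | no a  | no b  = a , b , refl , refl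
      kept-injective : ∀ {u v} .{p p′} → kept {i = i} {H} u p ≡ kept v p′ → u ≡ v
      kept-injective refl = refl
      alone′ : ∀ {u w u′} → label H u ≡ label H w → π′ u ≢ π′ w → π′ u′ ≡ π′ u → u′ ≡ u
      alone′ {u} {w} {u′} l ne e with both l ne
      ... | p , p′ , fu , fw with label H u′ ≟ i | alone F {u = kept u p} {w = kept w p′} {u′ = fv u′} l
                   (λ q → ne (trans (cong π fu) (trans q (sym (cong π fw))))) (trans e (cong π fu))
      ...   | no _ | eq = kept-injective eq
      down : ∀ {u w z} → label H u ≡ label H w → π′ u ≢ π′ w →
             Joined (fuse i H) π (π′ u) z → Joined H π′ (π′ u) z
      down {u} {w} l ne (u₁ , z₁ , eu , ez , e) with both l ne
      ... | p , p′ , fu , fw with alone F {u = kept u p} {w = kept w p′} {u′ = u₁} l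
                   (λ q → ne (trans (cong π fu) (trans q (sym (cong π fw))))) (trans eu (cong π fu))
      down l ne (_ , kept z₂ q , eu , ez , e) | p , p′ , fu , fw | refl =
        _ , z₂ , refl , trans (on-kept z₂ q) ez , e
      down l ne (_ , merged q , eu , ez , (w , lw , e)) | p , p′ , fu , fw | refl =
        _ , w , refl , trans (on-merged lw) ez , e
      F′ : Future H π′
      F′ = record { later = later′ ; alone = alone′ ; sound = sound′ }
        where
        later′ : ∀ {u w z} → label H u ≡ label H w → π′ u ~ z → Joined H π′ (π′ u) z ⊎ π′ w ~ z
        later′ {u} {w} {z} l a with π′ u ≟ᵂ π′ w
        ... | yes e = inj₂ (subst (_~ z) e a)
        ... | no ne with both l ne
        ...   | p , p′ , fu , fw with later F {u = kept u p} {w = kept w p′} {z} l (subst (λ x → π x ~ z) fu a)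
        ...     | inj₁ j = inj₁ (down l ne (subst (λ x → Joined (fuse i H) π (π x) z) (sym fu) j))
        ...     | inj₂ a′ = inj₂ (subst (λ x → π x ~ z) (sym fw) a′)
        sound′ : ∀ {u w} → Edge H u w → π′ u ~ π′ w ⊎ π′ u ≡ π′ w
        sound′ {u} {w} e with label H u ≟ i | label H w ≟ i
        ... | yes _ | yes _ = inj₂ refl
        ... | yes l | no  _ = sound F (u , l , e)
        ... | no  _ | yes l = sound F (w , l , e)
        ... | no  _ | no  _ = sound F e

  module _ {k} {H K : LabelledGraph k} {π} (F : Future (union H K) π) where

    -- If `u` shares its label with a vertex of another image, then `u` is the only copy of its
    -- image, so an edge present at that image lies on the side of `u`.
    future-unionˡ : Future H (π ∘ inj₁)
    future-unionˡ = record
      { later = later′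
      ; alone = λ l ne e → inj₁-injective (alone F {u = inj₁ _} {inj₁ _} {inj₁ _} l ne e)
      ; sound = λ e → sound F (inj₁ e)
      }
      where
      later′ : ∀ {u w z} → label H u ≡ label H w → π (inj₁ u) ~ z →
               Joined H (π ∘ inj₁) (π (inj₁ u)) z ⊎ π (inj₁ w) ~ z
      later′ {u} {w} {z} l a with π (inj₁ u) ≟ᵂ π (inj₁ w)
      ... | yes e = inj₂ (subst (_~ z) e a)
      ... | no ne with later F {inj₁ u} {inj₁ w} l a
      ...   | inj₂ a′ = inj₂ a′
      ...   | inj₁ (_ , _ , eu , ez , inj₁ e) = inj₁ (_ , _ , eu , ez , e)
      ...   | inj₁ (_ , _ , eu , ez , inj₂ e) =
              case alone F {u = inj₁ u} {inj₁ w} l ne eu of λ ()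

    future-unionʳ : Future K (π ∘ inj₂)
    future-unionʳ = record
      { later = later′
      ; alone = λ l ne e → inj₂-injective (alone F {u = inj₂ _} {inj₂ _} {inj₂ _} l ne e)
      ; sound = λ e → sound F (inj₂ e)
      }
      where
      later′ : ∀ {u w z} → label K u ≡ label K w → π (inj₂ u) ~ z →
               Joined K (π ∘ inj₂) (π (inj₂ u)) z ⊎ π (inj₂ w) ~ z
      later′ {u} {w} {z} l a with π (inj₂ u) ≟ᵂ π (inj₂ w)
      ... | yes e = inj₂ (subst (_~ z) e a)
      ... | no ne with later F {inj₂ u} {inj₂ w} l a
      ...   | inj₂ a′ = inj₂ a′
      ...   | inj₁ (_ , _ , eu , ez , inj₂ e) = inj₁ (_ , _ , eu , ez , e)
      ...   | inj₁ (_ , _ , eu , ez , inj₁ e) =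
              case alone F {u = inj₂ u} {inj₂ w} l ne eu of λ ()

search-Fusion : ∀ {k} (e : FusionExpr k) → Searchable (Vertex (evalFusion e))
search-Fusion (atom i m)  = any?
search-Fusion (η i j _ e) = search-Fusion e
search-Fusion (ρ i j e)   = search-Fusion e
search-Fusion (e ⊕ e′)    = search-⊎ (search-Fusion e) (search-Fusion e′)
-- The proofs inside `kept` and `merged` are irrelevant, so a test with one proof settles all of
-- them: the search covers the kept vertices and the at most one merged vertex.
search-Fusion (θ i e) {Q} Q? = decide (search-Fusion e keptQ?) (search-Fusion e (λ v → label H v ≟ i))
  where
  H = evalFusion e
  keptQ : Vertex H → Set
  keptQ v = Σ (label H v ≢ i) λ p → Q (kept v p)
  keptQ? : ∀ v → Dec (keptQ v)
  keptQ? v with label H v ≟ i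
  ... | yes l = no λ (p , _) → p l
  ... | no p  = map′ (p ,_) proj₂ (Q? (kept v p))
  decide : Dec (∃[ v ] keptQ v) → Dec (∃[ v ] label H v ≡ i) → Dec (∃[ a ] Q a)
  decide (yes (v , p , q)) _ = yes (kept v p , q)
  decide (no ¬kept) (no none) = no λ
    { (kept v p , q) → ¬kept (v , (λ l → Irrelevant.⊥-elim (p l)) , q)
    ; (merged p , q) → Irrelevant.⊥-elim (none p) }
  decide (no ¬kept) (yes found) with Q? (merged found)
  ... | yes q = yes (merged found , q)
  ... | no ¬q = no λ
    { (kept v p , q) → ¬kept (v , (λ l → Irrelevant.⊥-elim (p l)) , q)
    ; (merged p , q) → ¬q q }

-- Stars and binary trees of hubs

cloud : ∀ {S} m → (Vec Bool m → Vec Bool S) → Term S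
cloud zero    g = leaf (g [])
cloud (suc m) g = cloud m (g ∘ (false ∷_)) ∥ cloud m (g ∘ (true ∷_))

point : ∀ {S m} (g : Vec Bool m → Vec Bool S) → Vec Bool m → V (cloud m g)
point g []          = tt
point g (false ∷ p) = inj₁ (point (g ∘ (false ∷_)) p)
point g (true ∷ p)  = inj₂ (point (g ∘ (true ∷_)) p)

port-point : ∀ {S m} (g : Vec Bool m → Vec Bool S) p i →
             port (cloud m g) (point g p) i ≡ lookup (g p) i
port-point g []          i = refl
port-point g (false ∷ p) i = port-point (g ∘ (false ∷_)) p i
port-point g (true ∷ p)  i = port-point (g ∘ (true ∷_)) p i

port-cloud : ∀ {S m} (g : Vec Bool m → Vec Bool S) {i b} → (∀ p → lookup (g p) i ≡ b) →
             ∀ v → port (cloud m g) v i ≡ b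
port-cloud {m = zero}  g h v        = h []
port-cloud {m = suc m} g h (inj₁ v) = port-cloud (g ∘ (false ∷_)) (h ∘ (false ∷_)) v
port-cloud {m = suc m} g h (inj₂ v) = port-cloud (g ∘ (true ∷_)) (h ∘ (true ∷_)) v

cloud-edgeless : ∀ {S m} (g : Vec Bool m → Vec Bool S) u v → adj (cloud m g) u v ≡ false
cloud-edgeless {m = zero}  g u v = refl
cloud-edgeless {m = suc m} g (inj₁ u) (inj₁ v) = cloud-edgeless (g ∘ (false ∷_)) u v
cloud-edgeless {m = suc m} g (inj₁ u) (inj₂ v) = refl
cloud-edgeless {m = suc m} g (inj₂ u) (inj₁ v) = refl
cloud-edgeless {m = suc m} g (inj₂ u) (inj₂ v) = cloud-edgeless (g ∘ (true ∷_)) u v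

-- A star whose leaves are attached to all possible sets of the slots suc i.
gadget : ∀ n → Term (suc n)
gadget n = close zero (cloud n (true ∷_))

tip : ∀ {n} → Vec Bool n → V (gadget n)
tip p = old (point (true ∷_) p)

port-tip : ∀ {n} (p : Vec Bool n) i → port (gadget n) (tip p) (suc i) ≡ lookup p i
port-tip p i = port-point (true ∷_) p (suc i)

centre-adj : ∀ n v → adj (gadget n) hub (old v) ≡ true
centre-adj n v = port-cloud (true ∷_) (λ _ → refl) v

tip-adj : ∀ n u v w → adj (gadget n) (old u) w ≡ true → adj (gadget n) (old v) w ≡ true
tip-adj n u v hub     e = centre-adj n v
tip-adj n u v (old w) e = contradiction (trans (sym (cloud-edgeless (true ∷_) u w)) e) false≢true

gadget-connected : ∀ n → Connected (gadget n)
gadget-connected n = linked⇒connected λ v → centre-adj n v ∷ []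

∅ : ∀ {n} → Vec Bool n
∅ = replicate _ false

⁅_⁆ : ∀ {n} → Fin n → Vec Bool n
⁅ i ⁆ = tabulate λ j → does (j ≟ i)

port-∅ : ∀ {n} (i : Fin n) → port (gadget n) (tip ∅) (suc i) ≡ false
port-∅ i = trans (port-tip ∅ i) (lookup-replicate i false)

port-⁅⁆ : ∀ {n} (i : Fin n) → port (gadget n) (tip ⁅ i ⁆) (suc i) ≡ true
port-⁅⁆ i = trans (port-tip ⁅ i ⁆ i) (trans (lookup∘tabulate _ i) (dec-true (i ≟ i) refl))

port-⁅⁆-other : ∀ {n} (i j : Fin n) → j ≢ i → port (gadget n) (tip ⁅ i ⁆) (suc j) ≡ false
port-⁅⁆-other i j j≢i = trans (port-tip ⁅ i ⁆ j) (trans (lookup∘tabulate _ j) (dec-false (j ≟ i) j≢i))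

-- A complete binary tree of hubs, one slot per level, over gadgets.
nest : ∀ {n} → List (Fin n) → Term (suc n)
nest {n} []  = gadget n
nest (σ ∷ l) = close (suc σ) (nest l ∥ nest l)

side : ∀ {n} (σ : Fin n) l → Bool → nest l ↪ nest (σ ∷ l)
side σ l false = inᶜ ∘↪ inˡ
side σ l true  = inᶜ ∘↪ inʳ

sides-apart : ∀ {n} (σ : Fin n) l b u v →
              adj (nest (σ ∷ l)) (to (side σ l b) u) (to (side σ l (not b)) v) ≡ false
sides-apart σ l false u v = refl
sides-apart σ l true  u v = refl

side-hub : ∀ {n} (σ : Fin n) l b v → adj (nest (σ ∷ l)) (to (side σ l b) v) hub ≡ port (nest l) v (suc σ)
side-hub σ l false v = refl
side-hub σ l true  v = refl

side-port : ∀ {n} (σ : Fin n) l b v {τ} → τ ≢ suc σ →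
            port (nest (σ ∷ l)) (to (side σ l b) v) τ ≡ port (nest l) v τ
side-port σ l false v τ≢σ = port-other (suc σ) (nest l ∥ nest l) (inj₁ v) τ≢σ
side-port σ l true  v τ≢σ = port-other (suc σ) (nest l ∥ nest l) (inj₂ v) τ≢σ

side-near : ∀ {n} (σ : Fin n) l b u u′ → (∀ v → adj (nest l) u v ≡ true → adj (nest l) u′ v ≡ true) →
            ∀ v → adj (nest (σ ∷ l)) (to (side σ l b) u) (old v) ≡ true →
            adj (nest (σ ∷ l)) (to (side σ l b) u′) (old v) ≡ true
side-near σ l false u u′ h (inj₁ v) e = h v e
side-near σ l true  u u′ h (inj₂ v) e = h v e

_∉_ : ∀ {n} → Fin n → List (Fin n) → Set
σ ∉ l = All.All (σ ≢_) l

port-vertex : ∀ {n} (l : List (Fin n)) {σ} → σ ∉ l → ∃[ v ] port (nest l) v (suc σ) ≡ true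
port-vertex []      {σ} []         = tip ⁅ σ ⁆ , port-⁅⁆ σ
port-vertex (τ ∷ l) {σ} (σ≢τ ∷ σ∉) = let v , e = port-vertex l σ∉ in
  to (side τ l false) v , trans (side-port τ l false v (σ≢τ ∘ suc-injective)) e

nest-connected : ∀ {n} (l : List (Fin n)) → Unique l → Connected (nest l)
nest-connected {n} []  []        = gadget-connected n
nest-connected (σ ∷ l) (σ∉ ∷ ul) = linked⇒connected (linked-∥ linked linked)
  where linked = connected⇒linked (nest-connected l ul) (port-vertex l σ∉)

-- Fullness means that some star of the tree lies wholly in `X`. `Lacking` is its constructive
-- negation, with a missing vertex in every star.
Full : ∀ {n} (l : List (Fin n)) → (V (nest l) → Bool) → Set
Full []      X = ∀ v → X v ≡ true
Full (σ ∷ l) X = ∃[ b ] Full l (X ∘ to (side σ l b))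

Lacking : ∀ {n} (l : List (Fin n)) → (V (nest l) → Bool) → Set
Lacking []      X = ∃[ v ] X v ≡ false
Lacking (σ ∷ l) X = ∀ b → Lacking l (X ∘ to (side σ l b))

full? : ∀ {n} (l : List (Fin n)) X → Full l X ⊎ Lacking l X
full? {n} [] X = all-or-counterexample (gadget n) X
full? (σ ∷ l) X with full? l (X ∘ to (side σ l false)) | full? l (X ∘ to (side σ l true))
... | inj₁ f | _      = inj₁ (false , f)
... | inj₂ _ | inj₁ f = inj₁ (true , f)
... | inj₂ g | inj₂ h = inj₂ λ { false → g ; true → h }

full-mono : ∀ {n} (l : List (Fin n)) {X Y} → (∀ v → X v ≡ true → Y v ≡ true) → Full l X → Full l Y
full-mono []      h f       = λ v → h v (f v)
full-mono (σ ∷ l) h (b , f) = b , full-mono l (λ v → h (to (side σ l b) v)) f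

full-all : ∀ {n} (l : List (Fin n)) {X} → (∀ v → X v ≡ true) → Full l X
full-all []      h = h
full-all (σ ∷ l) h = false , full-all l (λ v → h (to (side σ l false) v))

full-gadget : ∀ {n} (l : List (Fin n)) {X} → Full l X →
              Σ (gadget n ↪ nest l) λ g → ∀ v → X (to g v) ≡ true
full-gadget []      f       = record { to = id ; adj-to = λ _ _ → refl } , f
full-gadget (σ ∷ l) (b , f) = let g , h = full-gadget l f in side σ l b ∘↪ g , h

-- Fans: distinguishable vertices at a union

module _ {A : Set} (X₁ X₂ : A → Bool) where

  _∪_ : A → Bool
  _∪_ v = X₁ v ∨ X₂ v

  Shared : A → Set
  Shared r = X₁ r ≡ true × X₂ r ≡ true

  -- For the union of two subexpressions with vertex sets X₁ and X₂: r will be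
  -- fused across the union, or the pair r, z is joined later.
  Anchor : A → A → Set
  Anchor r z = Shared r ⊎ ((X₁ r ∨ X₂ r) ≡ true × ¬ (X₁ r ≡ true × X₁ z ≡ true)
                                               × ¬ (X₂ r ≡ true × X₂ z ≡ true))

  anchor-∪ : ∀ {r z} → Anchor r z → (X₁ r ∨ X₂ r) ≡ true
  anchor-∪ (inj₁ (e , _)) rewrite e = refl
  anchor-∪ (inj₂ (e , _)) = e

  ∨-false : ∀ {z} → (X₁ z ∨ X₂ z) ≡ false → X₁ z ≡ false × X₂ z ≡ false
  ∨-false {z} e with X₁ z | X₂ z
  ... | false | false = refl , refl

  cut-anchor : ∀ {r z} → (X₁ r ∨ X₂ r) ≡ true → (X₁ z ∨ X₂ z) ≡ false → Anchor r z
  cut-anchor xr xz = let z₁ , z₂ = ∨-false xz in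
    inj₂ (xr , (λ (_ , e) → false≢true (trans (sym z₁) e)) , (λ (_ , e) → false≢true (trans (sym z₂) e)))

-- base is joined to none of the z i, so it needs one label more than the r i;
-- twig σ is kept for a hub of slot σ still to come.
record Fan {n} (l : List (Fin n)) (X₁ X₂ : V (nest l) → Bool) : Set where
  field
    system    : System (nest l) (Anchor X₁ X₂) (suc (length l))
    base      : V (nest l)
    base∈     : (X₁ base ∨ X₂ base) ≡ true
    base-far  : ∀ i → adj (nest l) base (z system i) ≡ false
    base-port : ∀ τ → port (nest l) base (suc τ) ≡ false
    twig      : ∀ {σ} → σ ∉ l → ∃[ w ] ((X₁ w ∨ X₂ w) ≡ true
                  × port (nest l) w (suc σ) ≡ true
                  × (∀ τ → τ ≢ σ → port (nest l) w (suc τ) ≡ false)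
                  × (∀ v → adj (nest l) w v ≡ true → adj (nest l) base v ≡ true))

open Fan

-- The anchored edge starts at the centre. If the centre occurs on both sides, it is shared and any
-- leaf serves as the other end. If it occurs on one side only, the vertex missing from that side is
-- a leaf, and the edge to it lies within neither side.
fan-gadget : ∀ {n} X₁ X₂ → Lacking {n} [] X₁ → Lacking [] X₂ → Full [] (X₁ ∪ X₂) → Fan [] X₁ X₂
fan-gadget {n} X₁ X₂ (v₁ , e₁) (v₂ , e₂) full = anchored (X₁ hub) (X₂ hub) refl refl v₁ e₁ v₂ e₂
  where
  fan : ∀ w → Anchor X₁ X₂ hub (old w) → Fan [] X₁ X₂
  fan w a = record
    { system    = extend no-system hub (old w) a (centre-adj n w) (λ ())
    ; base      = tip ∅
    ; base∈     = full (tip ∅)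
    ; base-far  = λ { zero → cloud-edgeless (true ∷_) (point (true ∷_) ∅) w }
    ; base-port = port-∅
    ; twig      = λ {σ} _ → tip ⁅ σ ⁆ , full _ , port-⁅⁆ σ , port-⁅⁆-other σ , tip-adj n _ _
    }
  anchored : ∀ a b → X₁ hub ≡ a → X₂ hub ≡ b → ∀ v₁ → X₁ v₁ ≡ false → ∀ v₂ → X₂ v₂ ≡ false → Fan [] X₁ X₂
  anchored true  true  h₁ h₂ _ _ _ _ = fan (point (true ∷_) ∅) (inj₁ (h₁ , h₂))
  anchored true  false h₁ h₂ hub     e₁ _ _ = contradiction (trans (sym e₁) h₁) false≢true
  anchored true  false h₁ h₂ (old w) e₁ _ _ = fan w (inj₂ (full hub ,
    (λ (_ , e) → false≢true (trans (sym e₁) e)) , (λ (e , _) → false≢true (trans (sym h₂) e))))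
  anchored false true  h₁ h₂ _ _ hub     e₂ = contradiction (trans (sym e₂) h₂) false≢true
  anchored false true  h₁ h₂ _ _ (old w) e₂ = fan w (inj₂ (full hub ,
    (λ (e , _) → false≢true (trans (sym h₁) e)) , (λ (_ , e) → false≢true (trans (sym e₂) e))))
  anchored false false h₁ h₂ _ _ _ _ =
    contradiction (trans (sym (cong₂ _∨_ h₁ h₂)) (full hub)) false≢true

-- The pair that a hub and its subtree not b add to a fan F in the subtree b.
record Extra {n} σ (l : List (Fin n)) (X₁ X₂ : V (nest (σ ∷ l)) → Bool) b
             (F : Fan l (X₁ ∘ to (side σ l b)) (X₂ ∘ to (side σ l b))) : Set where
  field
    r₀ z₀    : V (nest (σ ∷ l))
    anchored : Anchor X₁ X₂ r₀ z₀
    edge₀    : adj (nest (σ ∷ l)) r₀ z₀ ≡ true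
    indep₀   : ∀ i → adj (nest (σ ∷ l)) r₀ (to (side σ l b) (z (system F) i)) ≡ true →
               adj (nest (σ ∷ l)) (to (side σ l b) (r (system F) i)) z₀ ≡ true → ⊥
    base₀    : adj (nest (σ ∷ l)) (to (side σ l b) (base F)) z₀ ≡ false

grow : ∀ {n} {σ} {l : List (Fin n)} {X₁ X₂ b F} → Extra σ l X₁ X₂ b F → Fan (σ ∷ l) X₁ X₂
grow {σ = σ} {l} {X₁} {X₂} {b} {F} E = record
  { system    = extend (map-system s id (system F)) r₀ z₀ anchored edge₀ indep₀
  ; base      = to s (base F)
  ; base∈     = base∈ F
  ; base-far  = λ { zero → base₀ ; (suc i) → trans (adj-to s _ _) (base-far F i) }
  ; base-port = λ τ → port-side-false (base F) τ (base-port F τ)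
  ; twig      = λ { {σ′} (σ′≢σ ∷ σ′∉) → let w , xw , pw , qw , fw = twig F σ′∉ in
                    to s w , xw , trans (side-port σ l b w (σ′≢σ ∘ suc-injective)) pw ,
                    (λ τ ne → port-side-false w τ (qw τ ne)) ,
                    (λ v → near w (qw σ (≢-sym σ′≢σ)) fw v) }
  }
  where
  open Extra E
  s = side σ l b
  port-side-false : ∀ v τ → port (nest l) v (suc τ) ≡ false → port (nest (σ ∷ l)) (to s v) (suc τ) ≡ false
  port-side-false v τ e with τ ≟ σ
  ... | yes refl = port-closed (suc τ) (nest l ∥ nest l) (to s v)
  ... | no τ≢σ   = trans (side-port σ l b v (τ≢σ ∘ suc-injective)) e
  near : ∀ w → port (nest l) w (suc σ) ≡ false →
         (∀ v → adj (nest l) w v ≡ true → adj (nest l) (base F) v ≡ true) →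
         ∀ v → adj (nest (σ ∷ l)) (to s w) v ≡ true → adj (nest (σ ∷ l)) (to s (base F)) v ≡ true
  near w pw fw hub e = contradiction (trans (sym pw) (trans (sym (side-hub σ l b w)) e)) false≢true
  near w pw fw (old v) e = side-near σ l b w (base F) fw v e

mutual
  -- Induction along `l`: the subtree with the full star gives the smaller fan, and `extra` finds
  -- one more pair from the hub and the other subtree. There `inside` returns to `fan` at the
  -- shorter list.
  fan : ∀ {n} (l : List (Fin n)) → Unique l → ∀ X₁ X₂ → Lacking l X₁ → Lacking l X₂ →
        Full l (X₁ ∪ X₂) → Fan l X₁ X₂
  fan []      _          X₁ X₂ l₁ l₂ full       = fan-gadget X₁ X₂ l₁ l₂ full
  fan (σ ∷ l) (σ∉ ∷ ul) X₁ X₂ l₁ l₂ (b , full) = grow (extra σ l σ∉ ul X₁ X₂ l₁ l₂ b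
    (fan l ul _ _ (l₁ b) (l₂ b) full))

  extra : ∀ {n} σ (l : List (Fin n)) → σ ∉ l → Unique l → ∀ X₁ X₂ → Lacking (σ ∷ l) X₁ →
          Lacking (σ ∷ l) X₂ → ∀ b F → Extra σ l X₁ X₂ b F
  extra σ l σ∉ ul X₁ X₂ l₁ l₂ b F =
    by-cases (search-V (nest l) (λ v → ≡true? ((X₁ ∪ X₂) (to s′ v)))) ((X₁ ∪ X₂) hub) refl
    where
    s = side σ l b
    s′ = side σ l (not b)
    not-apart : ∀ {u v} → adj (nest (σ ∷ l)) (to s u) (to s′ v) ≢ true
    not-apart e = false≢true (trans (sym (sides-apart σ l b _ _)) e)
    not-apart′ : ∀ {u v} → adj (nest (σ ∷ l)) (to s′ u) (to s v) ≢ true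
    not-apart′ {u} {v} e = not-apart {v} {u} (trans (adj-sym (nest (σ ∷ l)) (to s v) (to s′ u)) e)
    by-cases : Dec (∃[ v ] (X₁ ∪ X₂) (to s′ v) ≡ true) → ∀ h → (X₁ ∪ X₂) hub ≡ h → Extra σ l X₁ X₂ b F
    -- The union meets the other subtree: that subtree supplies an anchored edge, which has no
    -- contact with the subtree `b`.
    by-cases (yes (v , xv)) _ _ = let r , z , a , e = inside l ul _ _ (l₁ (not b)) (l₂ (not b)) v xv in record
      { r₀ = to s′ r ; z₀ = to s′ z ; anchored = a ; edge₀ = trans (adj-to s′ _ _) e
      ; indep₀ = λ i e _ → not-apart′ e ; base₀ = sides-apart σ l b _ _ }
    -- The union contains the hub and nothing of the other subtree: the edge from the hub to a
    -- vertex there leaves the union. That end is adjacent to nothing in the subtree `b`.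
    by-cases (no none) true xh = let p , pσ = port-vertex l σ∉ in record
      { r₀ = hub ; z₀ = to s′ p ; anchored = cut-anchor X₁ X₂ xh (Bool.¬-not λ e → none (p , e))
      ; edge₀ = trans (adj-sym (nest (σ ∷ l)) hub (to s′ p)) (trans (side-hub σ l (not b) p) pσ)
      ; indep₀ = λ i _ e → not-apart e ; base₀ = sides-apart σ l b _ _ }
    -- The hub itself is missing: the twig kept for its slot is still to be joined to it. The
    -- neighbours of the twig inside `nest l` are neighbours of the base, hence none of the `z i`;
    -- and the base is not attached to the hub.
    by-cases (no none) false xh = let w , xw , pw , _ , fw = twig F σ∉ in record
      { r₀ = to s w ; z₀ = hub ; anchored = cut-anchor X₁ X₂ xw xh
      ; edge₀ = trans (side-hub σ l b w) pw
      ; indep₀ = λ i e _ → false≢true (trans (sym (base-far F i)) (fw _ (trans (sym (adj-to s _ _)) e)))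
      ; base₀ = trans (side-hub σ l b (base F)) (base-port F σ) }

  -- If the union misses a vertex of the tree, connectedness gives an edge that leaves it. If it
  -- covers the tree, some star is full and the fan of the whole tree has a pair to offer.
  inside : ∀ {n} (l : List (Fin n)) → Unique l → ∀ X₁ X₂ → Lacking l X₁ → Lacking l X₂ →
           ∀ v → (X₁ ∪ X₂) v ≡ true → ∃[ r ] ∃[ z ] (Anchor X₁ X₂ r z × adj (nest l) r z ≡ true)
  inside l ul X₁ X₂ l₁ l₂ v xv with all-or-counterexample (nest l) (X₁ ∪ X₂)
  ... | inj₁ all = let s = system (fan l ul X₁ X₂ l₁ l₂ (full-all l all))
                   in r s zero , z s zero , anchor s zero , edge s zero
  ... | inj₂ (w , xw) = let r , z , xr , xz , e = cut-edge (X₁ ∪ X₂) (nest-connected l ul v w) xv xw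
                        in r , z , cut-anchor X₁ X₂ xr xz , e

-- The lower bound on fusion-width

distinct-labels : ∀ {k m} (f : Fin m → Fin k) → (∀ {i j} → i ≢ j → f i ≢ f j) → m ≤ k
distinct-labels f ne = injective⇒≤ {f = f} λ {i} {j} e → decidable-stable (i ≟ j) λ i≢j → ne i≢j e

module _ {S} (t : Term S) where

  _~_ : V⁺ t → V⁺ t → Set
  u ~ v = adj⁺ t u v ≡ true

  FutureOf : ∀ {k} (H : LabelledGraph k) → (Vertex H → V⁺ t) → Set
  FutureOf = Future (≟-V⁺ t) _~_

  -- At the root every adjacency is already an edge and every final vertex has one copy, so the
  -- first alternative of `later` always holds.
  future-generated : ∀ {k} {H : LabelledGraph k} → H Generates (graph t) →
                     Σ (Vertex H → V⁺ t) λ π → FutureOf H π × (∀ w → ∃[ v ] π v ≡ w)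
                       × (∀ {u v} → π u ≡ π v → u ≡ v)
  future-generated {H = H} (φ , edges) = π , record
    { later = λ {u} {w} {z} _ a → let v , e = onto z in
        inj₁ (u , v , refl , e , Equivalence.from (edges u v) (trans (cong (adj⁺ t (π u)) e) a))
    ; alone = λ _ _ e → π-injective e
    ; sound = λ {u} {w} e → inj₁ (Equivalence.to (edges u w) e)
    } , onto , π-injective
    where
    module φ = Inverse φ
    module ψ = Inverse (V⁺↔Fin t)
    π : Vertex H → V⁺ t
    π v = ψ.from (φ.to v)
    onto : ∀ w → ∃[ v ] π v ≡ w
    onto w = φ.from (ψ.to w) , trans (cong ψ.from (φ.strictlyInverseˡ (ψ.to w))) (ψ.strictlyInverseʳ w)
    π-injective : ∀ {u v} → π u ≡ π v → u ≡ v
    π-injective {u} {v} e = trans (sym (φ.strictlyInverseʳ u)) (trans (cong φ.from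
      (trans (sym (ψ.strictlyInverseˡ _)) (trans (cong ψ.to e) (ψ.strictlyInverseˡ _)))) (φ.strictlyInverseʳ v))

module FusionBound {n} (t : Term (suc n)) (l : List (Fin n)) (ul : Unique l) (ι : nest l ↪ t) where

  occurs? : ∀ {k} (e : FusionExpr k) (π : Vertex (evalFusion e) → V⁺ t) (v : V (nest l)) →
            Dec (∃[ u ] π u ≡ inj₂ (to ι v))
  occurs? e π v = search-Fusion e λ u → ≟-V⁺ t (π u) (inj₂ (to ι v))

  occurs : ∀ {k} (e : FusionExpr k) → (Vertex (evalFusion e) → V⁺ t) → V (nest l) → Bool
  occurs e π v = does (occurs? e π v)

  occurs⇒ : ∀ {k} (e : FusionExpr k) π {v} → occurs e π v ≡ true → ∃[ u ] π u ≡ inj₂ (to ι v)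
  occurs⇒ e π {v} x with occurs? e π v
  ... | yes u = u

  occurs⇐ : ∀ {k} (e : FusionExpr k) π {v} → (∃[ u ] π u ≡ inj₂ (to ι v)) → occurs e π v ≡ true
  occurs⇐ e π {v} u = dec-true (occurs? e π v) u

  -- The base and all `r i` need different labels: a copy of another of these vertices with the
  -- label of `r i` would end up adjacent to `z i`, as `near` shows. For the base this contradicts
  -- `base-far`; for `r i` and `r j` it holds both ways and contradicts `indep`.
  union-bound : ∀ {k} (e e′ : FusionExpr k) (π : Vertex (evalFusion (e ⊕ e′)) → V⁺ t) →
                FutureOf t (evalFusion (e ⊕ e′)) π →
                Fan l (occurs e (π ∘ inj₁)) (occurs e′ (π ∘ inj₂)) → suc (suc (length l)) ≤ k
  union-bound {k} e e′ π F K = distinct-labels (λ i → label H (copy i)) distinct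
    where
    open Future F
    _~~_ = _~_ t
    H = evalFusion (e ⊕ e′)
    X₁ = occurs e (π ∘ inj₁)
    X₂ = occurs e′ (π ∘ inj₂)
    vertex : Fin (suc (suc (length l))) → V (nest l)
    vertex zero    = base K
    vertex (suc i) = r (system K) i
    vertex∈ : ∀ i → (X₁ ∪ X₂) (vertex i) ≡ true
    vertex∈ zero    = base∈ K
    vertex∈ (suc i) = anchor-∪ X₁ X₂ (anchor (system K) i)
    find : ∀ v → (X₁ ∪ X₂) v ≡ true → ∃[ u ] π u ≡ inj₂ (to ι v)
    find v x with X₁ v in x₁ | X₂ v in x₂
    ... | true  | _    = let u , q = occurs⇒ e (π ∘ inj₁) x₁ in inj₁ u , q
    ... | false | true = let u , q = occurs⇒ e′ (π ∘ inj₂) x₂ in inj₂ u , q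
    copy : Fin (suc (suc (length l))) → Vertex H
    copy i = proj₁ (find (vertex i) (vertex∈ i))
    over : ∀ i → π (copy i) ≡ inj₂ (to ι (vertex i))
    over i = proj₂ (find (vertex i) (vertex∈ i))
    joined : ∀ i → π (copy (suc i)) ~~ inj₂ (to ι (z (system K) i))
    joined i = subst (λ w → adj⁺ t w _ ≡ true) (sym (over (suc i))) (trans (adj-to ι _ _) (edge (system K) i))
    near′ : ∀ i j → label H (copy (suc i)) ≡ label H (copy j) → π (copy (suc i)) ≢ π (copy j) →
            Anchor X₁ X₂ (r (system K) i) (z (system K) i) → π (copy j) ~~ inj₂ (to ι (z (system K) i))
    -- A shared `r i` has a copy on each side of the union, and `alone` would identify the two.
    near′ i j same ne (inj₁ (x₁ , x₂)) =
      let u₁ , q₁ = occurs⇒ e (π ∘ inj₁) x₁ ; u₂ , q₂ = occurs⇒ e′ (π ∘ inj₂) x₂ in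
      contradiction (trans (alone {u′ = inj₁ u₁} same ne (trans q₁ (sym (over (suc i)))))
                           (sym (alone {u′ = inj₂ u₂} same ne (trans q₂ (sym (over (suc i))))))) λ ()
    -- An edge present already would lie within one side of the union, which the anchor excludes; so
    -- it comes later and reaches equal labels alike.
    near′ i j same ne (inj₂ (_ , ¬₁ , ¬₂)) with later same (joined i)
    ... | inj₂ a = a
    ... | inj₁ (inj₁ u , inj₁ v , qu , qv , inj₁ _) =
      contradiction (occurs⇐ e (π ∘ inj₁) (u , trans qu (over (suc i))) , occurs⇐ e (π ∘ inj₁) (v , qv)) ¬₁
    ... | inj₁ (inj₂ u , inj₂ v , qu , qv , inj₂ _) =
      contradiction (occurs⇐ e′ (π ∘ inj₂) (u , trans qu (over (suc i))) , occurs⇐ e′ (π ∘ inj₂) (v , qv)) ¬₂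
    near : ∀ i j → label H (copy (suc i)) ≡ label H (copy j) → adj (nest l) (vertex j) (z (system K) i) ≡ true
    near i j same = trans (sym (adj-to ι _ _)) (subst (λ w → adj⁺ t w _ ≡ true) (over j) (decide (≟-V⁺ t _ _)))
      where
      decide : Dec (π (copy (suc i)) ≡ π (copy j)) → π (copy j) ~~ inj₂ (to ι (z (system K) i))
      decide (yes q) = subst (λ w → adj⁺ t w _ ≡ true) q (joined i)
      decide (no ne) = near′ i j same ne (anchor (system K) i)
    distinct : ∀ {i j} → i ≢ j → label H (copy i) ≢ label H (copy j)
    distinct {zero}  {zero}  ne _ = ne refl
    distinct {zero}  {suc j} ne q = false≢true (trans (sym (base-far K j)) (near j zero (sym q)))
    distinct {suc i} {zero}  ne q = false≢true (trans (sym (base-far K i)) (near i zero q))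
    distinct {suc i} {suc j} ne q = indep (system K) (ne ∘ cong suc) (near j (suc i) (sym q)) (near i (suc j) q)

  -- Descends to a union that is full although neither side is. A fusion loses no final vertex on
  -- the way down, so fullness passes through it.
  bound : ∀ {k} (e : FusionExpr k) π → FutureOf t (evalFusion e) π → Full l (occurs e π) →
          suc (suc (length l)) ≤ k
  bound (η i j i≢j e) π F full = bound e π (future-join _ _ i≢j F) full
  bound (ρ i j e)     π F full = bound e π (future-relabel _ _ F) full
  bound (e ⊕ e′) π F full with full? l (occurs e (π ∘ inj₁)) | full? l (occurs e′ (π ∘ inj₂))
  ... | inj₁ f | _      = bound e (π ∘ inj₁) (future-unionˡ _ _ F) f
  ... | inj₂ _ | inj₁ f = bound e′ (π ∘ inj₂) (future-unionʳ _ _ F) f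
  ... | inj₂ g | inj₂ h = union-bound e e′ π F (fan l ul _ _ g h (full-mono l split full))
    where
    split : ∀ v → occurs (e ⊕ e′) π v ≡ true → (occurs e (π ∘ inj₁) ∪ occurs e′ (π ∘ inj₂)) v ≡ true
    split v x with occurs⇒ (e ⊕ e′) π x
    ... | inj₁ u , q = cong (_∨ _) (occurs⇐ e (π ∘ inj₁) (u , q))
    ... | inj₂ u , q = trans (cong (occurs e (π ∘ inj₁) v ∨_) (occurs⇐ e′ (π ∘ inj₂) (u , q)))
                             (Bool.∨-zeroʳ _)
  bound (θ i e) π F full =
    let π′ , F′ , preimage = future-fuse _ _ (search-Fusion e) F in
    bound e π′ F′ (full-mono l (λ v x → let u , q = occurs⇒ (θ i e) π x ; u′ , q′ = preimage u
                                        in occurs⇐ e π′ (u′ , trans q′ q)) full)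
  -- A full atom would give the centre and a leaf of a star equal labels and no edge. The edge from
  -- the centre to the leaf, made later, would then join the leaf to itself.
  bound (atom i m) π F full with full-gadget l full
  ... | g , gX with occurs⇒ (atom i m) π (gX hub) | occurs⇒ (atom i m) π (gX (tip ∅))
  ...   | u , qu | w , qw with Future.later F {u} {w} {inj₂ (to ι (to g (tip ∅)))} refl
             (subst (λ x → adj⁺ t x _ ≡ true) (sym qu)
               (trans (adj-to ι _ _) (trans (adj-to g _ _) (centre-adj n _))))
  ...     | inj₂ a = contradiction
              (trans (sym (adj⁺-irrefl t (π w))) (subst (λ x → adj⁺ t (π w) x ≡ true) (sym qw) a)) false≢true

  fusion-bound : ∀ {k} → FusionGenerated (graph t) k → suc (suc (length l)) ≤ k
  fusion-bound (e , gen) = let π , F , onto , _ = future-generated t gen in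
    bound e π F (full-all l λ v → occurs⇐ e π (onto (inj₂ (to ι v))))

-- Filtrations and the ternary tree

Cut : ∀ {A : Set} → (A → Bool) → A → A → Set
Cut X r z = X r ≡ true × X z ≡ false

-- There are `suc m` copies, as no term is empty.
copies : ∀ {S} → ℕ → Term S → Term S
copies zero    t = t
copies (suc m) t = t ∥ copies m t

copy : ∀ {S} {t : Term S} {m} → Fin (suc m) → t ↪ copies m t
copy {m = zero}  zero    = record { to = id ; adj-to = λ _ _ → refl }
copy {m = suc m} zero    = inˡ
copy {m = suc m} (suc i) = inʳ ∘↪ copy i

copies-apart : ∀ {S} {t : Term S} {m} {i j : Fin (suc m)} → i ≢ j → ∀ u v →
               adj (copies m t) (to (copy i) u) (to (copy j) v) ≡ false
copies-apart {m = zero}  {zero}  {zero}  0≢0 _ _ = contradiction refl 0≢0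
copies-apart {m = suc m} {zero}  {zero}  0≢0 _ _ = contradiction refl 0≢0
copies-apart {m = suc m} {zero}  {suc _} _ _ _ = refl
copies-apart {m = suc m} {suc _} {zero}  _ _ _ = refl
copies-apart {m = suc m} {suc i} {suc j} i≢j = copies-apart (i≢j ∘ cong suc)

port-copy : ∀ {S} {t : Term S} {m} (i : Fin (suc m)) v τ → port (copies m t) (to (copy i) v) τ ≡ port t v τ
port-copy {m = zero}  zero    v τ = refl
port-copy {m = suc m} zero    v τ = refl
port-copy {m = suc m} (suc i) v τ = port-copy i v τ

linked-copies : ∀ {S} {σ : Fin S} {t} m → Linked σ t → Linked σ (copies m t)
linked-copies zero    l = l
linked-copies (suc m) l = linked-∥ l (linked-copies m l)

module _ {a : ℕ} where

  private
    S : ℕ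
    S = suc (suc (suc a))
    G : Term S
    G = gadget (suc (suc a))

  fixed : Fin a → Fin S
  fixed i = suc (suc (suc i))

  -- Two disjoint sets of few labels cannot both be rich (see half), so the
  -- subexpressions with a rich vertex set form a chain, described by X below.
  Rich : (t : Term S) → (V t → Bool) → Set
  Rich t X = (p : Vec Bool a) → ∃[ v ] (X v ≡ true × (∀ i → port t v (fixed i) ≡ lookup p i))

  rich? : ∀ t X → Dec (Rich t X)
  rich? t X = map′ (λ none p → decidable-stable (some? p) λ ne → none (p , ne)) (λ r (p , ne) → ne (r p))
                   (¬? (anySubset? λ p → ¬? (some? p)))
    where
    some? : ∀ p → Dec (∃[ v ] (X v ≡ true × (∀ i → port t v (fixed i) ≡ lookup p i)))
    some? p = search-V t λ v → ≡true? (X v) ×-dec all? λ i → port t v (fixed i) Bool.≟ lookup p i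

  Keeps : ∀ {s t : Term S} → s ↪ t → Set
  Keeps {s} {t} f = ∀ v i → port t (to f v) (fixed i) ≡ port s v (fixed i)

  rich-map : ∀ {s t : Term S} (f : s ↪ t) → Keeps f → ∀ {X} → Rich s (X ∘ to f) → Rich t X
  rich-map f k r p = let v , x , e = r p in to f v , x , λ i → trans (k v i) (e i)

  -- Time runs from the whole expression down along its rich subexpressions. `split` says that
  -- whatever a step loses lies in a poor set, and in `thin` the number `c` is that of labels.
  record Filtration (c : ℕ) (t : Term S) : Set where
    field
      X      : ℕ → V t → Bool
      top    : ∀ v → X 0 v ≡ true
      anti   : ∀ n {v} → X (suc n) v ≡ true → X n v ≡ true
      split  : ∀ n → ∃[ Y ] (¬ Rich t Y × (∀ v → X n v ≡ true → X (suc n) v ≡ true ⊎ Y v ≡ true))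
      bottom : ∃[ n ] ¬ Rich t (X n)
      thin   : ∀ n {m} → System t (Cut (X n)) m → m ≤ c

    antitone : ∀ {m n v} → m ≤ n → X n v ≡ true → X m v ≡ true
    antitone {zero}  {zero}  _       x = x
    antitone {zero}  {suc n} _       x = antitone {zero} {n} z≤n (anti n x)
    antitone {suc m} {suc n} (s≤s h) x with m≤n⇒m<n∨m≡n h
    ... | inj₁ m<n = antitone m<n (anti n x)
    ... | inj₂ refl = x

  open Filtration

  pull : ∀ {c} {s t : Term S} (f : s ↪ t) → Keeps f → Filtration c t → Filtration c s
  pull f k F = record
    { X      = λ n → X F n ∘ to f
    ; top    = λ v → top F (to f v)
    ; anti   = λ n → anti F n
    ; split  = λ n → let Y , ¬rich , h = split F n in Y ∘ to f , ¬rich ∘ rich-map f k , λ v → h (to f v)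
    ; bottom = let n , ¬rich = bottom F in n , ¬rich ∘ rich-map f k
    ; thin   = λ n s → thin F n (map-system f id s)
    }

  -- Holds exactly for `zero` and `suc zero`, which name the slots of the two kinds of spine hubs.
  -- Closing these leaves the ports of the `fixed` slots intact.
  Free : Fin (suc (suc a)) → Set
  Free σ = ∀ i → suc (suc i) ≢ σ

  keeps-close : ∀ {σ} {t : Term S} → Free σ → Keeps (inᶜ {σ = suc σ} {t})
  keeps-close {σ} {t} free v i = port-other (suc σ) t v (free i ∘ suc-injective)

  gadget-rich : ∀ {t} (f : G ↪ t) → Keeps f → ∀ {X} → (∀ v → X (to f v) ≡ true) → Rich t X
  -- The two leading bits concern the slots of the spine hubs; richness leaves them open.
  gadget-rich f k x p = to f (tip (false ∷ false ∷ p)) , x _ ,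
    λ i → trans (k _ i) (port-tip (false ∷ false ∷ p) (suc (suc i)))

  module _ (N : ℕ) where

    -- A ternary tree whose hubs use two slots alternately.
    spine : ℕ → Fin (suc (suc a)) → Fin (suc (suc a)) → Term S
    spine zero    σ σ′ = close (suc σ) (copies N G)
    spine (suc j) σ σ′ = close (suc σ) (G ∥ spine j σ′ σ ∥ spine j σ′ σ ∥ spine j σ′ σ)

    -- For vertices in the three subtrees both spine slots are closed by now. The link to the next
    -- hub above comes from the gadget that each level carries for this purpose, or at height 0 from
    -- one of the copies.
    spine-port : ∀ j {σ σ′} → σ ≢ σ′ → ∃[ v ] port (spine j σ σ′) v (suc σ′) ≡ true
    spine-port zero {σ} {σ′} σ≢σ′ = old (to (copy {m = N} zero) (tip ⁅ σ′ ⁆)) ,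
      trans (port-other (suc σ) (copies N G) _ (≢-sym σ≢σ′ ∘ suc-injective))
            (trans (port-copy {m = N} zero (tip ⁅ σ′ ⁆) (suc σ′)) (port-⁅⁆ σ′))
    spine-port (suc j) {σ} {σ′} σ≢σ′ = old (inj₁ (tip ⁅ σ′ ⁆)) ,
      trans (port-other (suc σ) (G ∥ spine j σ′ σ ∥ spine j σ′ σ ∥ spine j σ′ σ) (inj₁ (tip ⁅ σ′ ⁆))
                        (≢-sym σ≢σ′ ∘ suc-injective))
            (port-⁅⁆ σ′)

    gadget-linked : ∀ σ → Linked (suc σ) G
    gadget-linked σ = connected⇒linked (gadget-connected _) (tip ⁅ σ ⁆ , port-⁅⁆ σ)

    spine-connected : ∀ j {σ σ′} → σ ≢ σ′ → Connected (spine j σ σ′)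
    spine-linked : ∀ j {σ σ′} → σ ≢ σ′ → Linked (suc σ) (spine j σ′ σ)
    spine-connected zero    {σ} σ≢σ′ = linked⇒connected (linked-copies N (gadget-linked σ))
    spine-connected (suc j) {σ} σ≢σ′ = linked⇒connected
      (linked-∥ (gadget-linked σ) (linked-∥ l (linked-∥ l l)))
      where l = spine-linked j σ≢σ′
    spine-linked j σ≢σ′ = connected⇒linked (spine-connected j (≢-sym σ≢σ′)) (spine-port j (≢-sym σ≢σ′))

    gadget-at : ∀ {σ} σ′ → Fin (suc N) → G ↪ spine 0 σ σ′
    gadget-at σ′ i = inᶜ ∘↪ copy {m = N} i

    keeps-gadget-at : ∀ {σ σ′} → Free σ → ∀ i → Keeps (gadget-at {σ} σ′ i)
    keeps-gadget-at {σ} free i v j =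
      trans (keeps-close {σ} {copies N G} free (to (copy i) v) j) (port-copy i v (fixed j))

    module _ {c : ℕ} (N≮c : ¬ suc N ≤ c) where

      Claim : ∀ {t} → Filtration c t → ℕ → Set
      Claim {t} F m = ∃[ n ] System t (Cut (X F n)) m

      -- Take the last time `n` at which some gadget is whole. If `X n` misses a vertex, the path to
      -- it from that gadget is cut. If `X n` is everything, the poor set `Y` of the next step
      -- contains no whole gadget, so each of the `suc N` gadgets lies partly inside and partly
      -- outside `X (suc n)`. Each then has a cut edge of its own, which is too many for `thin`.
      claim-zero : ∀ {σ σ′} → Free σ → σ ≢ σ′ → (F : Filtration c (spine 0 σ σ′)) → Claim F 1
      claim-zero {σ} {σ′} free σ≢σ′ F =
        let m , poor = bottom F ; n , (i , full) , none = time m (none-poor _ poor)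
        in at n i full none
        where
        T = spine 0 σ σ′
        g : Fin (suc N) → G ↪ T
        g = gadget-at σ′
        Some : (V T → Bool) → Set
        Some Z = ∃[ i ] (∀ v → Z (to (g i) v) ≡ true)
        None : (V T → Bool) → Set
        None Z = ∀ i → ∃[ v ] Z (to (g i) v) ≡ false
        counterexample : ∀ Z i → ¬ (∀ v → Z (to (g i) v) ≡ true) → ∃[ v ] Z (to (g i) v) ≡ false
        counterexample Z i ¬full with all-or-counterexample G (Z ∘ to (g i))
        ... | inj₁ full = contradiction full ¬full
        ... | inj₂ ce   = ce
        none-poor : ∀ Z → ¬ Rich T Z → None Z
        none-poor Z poor i = counterexample Z i λ full →
          poor (gadget-rich (g i) (keeps-gadget-at {σ′ = σ′} free i) full)
        some? : ∀ Z → Some Z ⊎ None Z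
        some? Z with any? (λ i → ¬? (search-V G (λ v → Z (to (g i) v) Bool.≟ false)))
        ... | yes (i , ¬ce) = inj₁ (i , λ v → Bool.¬-not λ e → ¬ce (v , e))
        ... | no none = inj₂ λ i → counterexample Z i λ full →
              none (i , λ (v , e) → false≢true (trans (sym e) (full v)))
        time : ∀ n → None (X F n) → ∃[ m ] (Some (X F m) × None (X F (suc m)))
        time zero    none =
          let v , e = none zero in contradiction (trans (sym e) (top F (to (g zero) v))) false≢true
        time (suc n) none with some? (X F n)
        ... | inj₁ some  = n , some , none
        ... | inj₂ none′ = time n none′
        at : ∀ n i → (∀ v → X F n (to (g i) v) ≡ true) → None (X F (suc n)) → Claim F 1
        at n i full none with all-or-counterexample T (X F n)
        ... | inj₂ (w , xw) =
          let r , z , xr , xz , e = cut-edge (X F n) (spine-connected 0 σ≢σ′ (to (g i) hub) w) (full hub) xw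
          in n , extend no-system r z (xr , xz) e (λ ())
        ... | inj₁ all = contradiction (thin F (suc n) cuts) N≮c
          where
          Y = proj₁ (split F n)
          cut : ∀ i → CutEdge G (X F (suc n) ∘ to (g i))
          cut i with none i | none-poor _ (proj₁ (proj₂ (split F n))) i
          ... | v , xv | w , yw with proj₂ (proj₂ (split F n)) (to (g i) w) (all _)
          ...   | inj₁ xw = cut-edge _ (gadget-connected _ w v) xw xv
          ...   | inj₂ y  = contradiction (trans (sym yw) y) false≢true
          cuts : System T (Cut (X F (suc n))) (suc N)
          cuts = record
            { r      = λ i → to (g i) (proj₁ (cut i))
            ; z      = λ i → to (g i) (proj₁ (proj₂ (cut i)))
            ; anchor = λ i → let _ , _ , xr , xz , _ = cut i in xr , xz
            ; edge   = λ i → let _ , _ , _ , _ , e = cut i in trans (adj-to (g i) _ _) e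
            ; indep  = λ i≢j e _ → false≢true (trans (sym (copies-apart i≢j _ _)) e)
            }

      module Step j {σ σ′} (freeσ : Free σ) (σ≢σ′ : σ ≢ σ′) (F : Filtration c (spine (suc j) σ σ′)) where

        private
          T K : Term S
          T = spine (suc j) σ σ′
          K = spine j σ′ σ

        child : Fin 3 → K ↪ (K ∥ K ∥ K)
        child zero             = inˡ
        child (suc zero)       = inʳ ∘↪ inˡ
        child (suc (suc zero)) = inʳ ∘↪ inʳ

        kid : Fin 3 → K ↪ T
        kid k = inᶜ ∘↪ inʳ ∘↪ child k

        closed-kid : Fin 3 → close (suc σ) K ↪ T
        closed-kid zero             = closeʳ ∘↪ closeˡ
        closed-kid (suc zero)       = closeʳ ∘↪ closeʳ ∘↪ closeˡ
        closed-kid (suc (suc zero)) = closeʳ ∘↪ closeʳ ∘↪ closeʳ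

        closed-kid-old : ∀ k v → to (closed-kid k) (old v) ≡ to (kid k) v
        closed-kid-old zero             v = refl
        closed-kid-old (suc zero)       v = refl
        closed-kid-old (suc (suc zero)) v = refl

        closed-kid-hub : ∀ k → to (closed-kid k) hub ≡ hub
        closed-kid-hub zero             = refl
        closed-kid-hub (suc zero)       = refl
        closed-kid-hub (suc (suc zero)) = refl

        keeps-kid : ∀ k → Keeps (kid k)
        keeps-kid k v i = trans (keeps-close {σ} {G ∥ K ∥ K ∥ K} freeσ (inj₂ (to (child k) v)) i) (port-child k)
          where
          port-child : ∀ k → port (K ∥ K ∥ K) (to (child k) v) (fixed i) ≡ port K v (fixed i)
          port-child zero             = refl
          port-child (suc zero)       = refl
          port-child (suc (suc zero)) = refl

        kids-apart : ∀ {k k′} → k ≢ k′ → ∀ u v → adj T (to (kid k) u) (to (kid k′) v) ≡ false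
        kids-apart {zero}           {zero}           ne _ _ = contradiction refl ne
        kids-apart {suc zero}       {suc zero}       ne _ _ = contradiction refl ne
        kids-apart {suc (suc zero)} {suc (suc zero)} ne _ _ = contradiction refl ne
        kids-apart {zero}           {suc zero}       _ _ _ = refl
        kids-apart {zero}           {suc (suc zero)} _ _ _ = refl
        kids-apart {suc zero}       {zero}           _ _ _ = refl
        kids-apart {suc zero}       {suc (suc zero)} _ _ _ = refl
        kids-apart {suc (suc zero)} {zero}           _ _ _ = refl
        kids-apart {suc (suc zero)} {suc zero}       _ _ _ = refl

        kid-filtration : ∀ k → Filtration c K
        kid-filtration k = pull (kid k) (keeps-kid k) F

        -- The new edge may end at the hub, which can have neighbours in the subtree `b`. Its other
        -- end has none there, and this suffices because `indep` only forbids both cross adjacencies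
        -- at once.
        extend-kid : ∀ {m} n {b k} → b ≢ k → System K (Cut (X F n ∘ to (kid b))) m →
                     CutEdge (close (suc σ) K) (X F n ∘ to (closed-kid k)) → System T (Cut (X F n)) (suc m)
        extend-kid n {b} {k} b≢k s (r₀ , z₀ , xr , xz , e) =
          extend (map-system (kid b) id s) (to (closed-kid k) r₀) (to (closed-kid k) z₀) (xr , xz)
            (trans (adj-to (closed-kid k) r₀ z₀) e) (λ i → indep₀ r₀ z₀ e i)
          where
          far : ∀ w v → adj T (to (closed-kid k) (old w)) (to (kid b) v) ≢ true
          far w v e = false≢true (trans (sym (kids-apart (≢-sym b≢k) w v))
            (trans (cong (λ x → adj T x (to (kid b) v)) (sym (closed-kid-old k w))) e))
          indep₀ : ∀ r₀ z₀ → adj (close (suc σ) K) r₀ z₀ ≡ true → ∀ i →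
                   adj T (to (closed-kid k) r₀) (to (kid b) (z s i)) ≡ true →
                   adj T (to (kid b) (r s i)) (to (closed-kid k) z₀) ≡ true → ⊥
          indep₀ (old w) _       _ i e₁ _  = far w (z s i) e₁
          indep₀ hub     (old w) _ i _  e₂ = far w (r s i)
            (trans (adj-sym T (to (closed-kid k) (old w)) (to (kid b) (r s i))) e₂)

        -- At the middle one of the three times, subtree b carries its cut edges, and
        -- the path from x to y through the hub is cut once more.
        middle : ∀ {x b y} → b ≢ x → b ≢ y →
                 (claims : ∀ k → Claim (kid-filtration k) (suc j)) →
                 proj₁ (claims b) ≤ proj₁ (claims x) → proj₁ (claims y) ≤ proj₁ (claims b) →
                 Claim F (suc (suc j))
        middle {x} {b} {y} b≢x b≢y claims b≤x y≤b with claims b | claims x | claims y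
        ... | n , s | n₁ , s₁ | n₂ , s₂ = n , by-hub (X F n hub) refl
          where
          in-x : X F n (to (kid x) (r s₁ zero)) ≡ true
          in-x = antitone F b≤x (proj₁ (anchor s₁ zero))
          out-y : X F n (to (kid y) (z s₂ zero)) ≡ false
          out-y = Bool.¬-not λ e → false≢true (trans (sym (proj₂ (anchor s₂ zero))) (antitone F y≤b e))
          path : ∀ v → Path (close (suc σ) K) (old v) hub
          path = spine-linked j σ≢σ′
          at-old : ∀ {k v b} → X F n (to (kid k) v) ≡ b → X F n (to (closed-kid k) (old v)) ≡ b
          at-old {k} {v} e = trans (cong (X F n) (closed-kid-old k v)) e
          at-hub : ∀ {k b} → X F n hub ≡ b → X F n (to (closed-kid k) hub) ≡ b
          at-hub {k} e = trans (cong (X F n) (closed-kid-hub k)) e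
          by-hub : ∀ h → X F n hub ≡ h → System T (Cut (X F n)) (suc (suc j))
          by-hub true  e = extend-kid n b≢y s (cut-edge _ (reverse (path _)) (at-hub {y} e) (at-old {y} out-y))
          by-hub false e = extend-kid n b≢x s (cut-edge _ (path _) (at-old {x} in-x) (at-hub {x} e))

        claim-step : (∀ k → Claim (kid-filtration k) (suc j)) → Claim F (suc (suc j))
        claim-step claims = sort (≤-total (t 0F) (t 1F)) (≤-total (t 1F) (t 2F)) (≤-total (t 0F) (t 2F))
          where
          t : Fin 3 → ℕ
          t k = proj₁ (claims k)
          0F 1F 2F : Fin 3
          0F = zero
          1F = suc zero
          2F = suc (suc zero)
          sort : t 0F ≤ t 1F ⊎ t 1F ≤ t 0F → t 1F ≤ t 2F ⊎ t 2F ≤ t 1F → t 0F ≤ t 2F ⊎ t 2F ≤ t 0F →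
                 Claim F (suc (suc j))
          sort (inj₁ p) (inj₁ q) _        = middle {2F} {1F} {0F} (λ ()) (λ ()) claims q p
          sort (inj₂ p) (inj₂ q) _        = middle {0F} {1F} {2F} (λ ()) (λ ()) claims p q
          sort (inj₁ p) (inj₂ q) (inj₁ s) = middle {1F} {2F} {0F} (λ ()) (λ ()) claims q s
          sort (inj₁ p) (inj₂ q) (inj₂ s) = middle {1F} {0F} {2F} (λ ()) (λ ()) claims p s
          sort (inj₂ p) (inj₁ q) (inj₁ s) = middle {2F} {0F} {1F} (λ ()) (λ ()) claims s p
          sort (inj₂ p) (inj₁ q) (inj₂ s) = middle {0F} {2F} {1F} (λ ()) (λ ()) claims s q

      claim : ∀ j {σ σ′} → Free σ → Free σ′ → σ ≢ σ′ → (F : Filtration c (spine j σ σ′)) → Claim F (suc j)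
      claim zero    fσ fσ′ σ≢σ′ F = claim-zero fσ σ≢σ′ F
      claim (suc j) fσ fσ′ σ≢σ′ F =
        claim-step λ k → claim j fσ′ fσ (≢-sym σ≢σ′) (kid-filtration k)
        where open Step j fσ σ≢σ′ F

-- Counting subsets

spread : ∀ {m} (B : Vec Bool m) → Vec Bool ∣ B ∣ → Vec Bool m
spread []          p       = []
spread (true ∷ B)  (b ∷ p) = b ∷ spread B p
spread (false ∷ B) p       = false ∷ spread B p

spread-injective : ∀ {m} (B : Vec Bool m) p q →
                   (∀ i → lookup B i ≡ true → lookup (spread B p) i ≡ lookup (spread B q) i) → p ≡ q
spread-injective []          []      []      h = refl
spread-injective (true ∷ B)  (_ ∷ p) (_ ∷ q) h = cong₂ _∷_ (h zero refl) (spread-injective B p q (h ∘ suc))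
spread-injective (false ∷ B) p       q       h = spread-injective B p q (h ∘ suc)

cover-count : ∀ {m} (B C : Vec Bool m) → (∀ i → lookup B i ≡ true ⊎ lookup C i ≡ true) → m ≤ ∣ B ∣ + ∣ C ∣
cover-count []          []          h = z≤n
cover-count (true ∷ B)  (true ∷ C)  h = s≤s (≤-trans (cover-count B C (h ∘ suc))
  (≤-trans (n≤1+n _) (≤-reflexive (sym (+-suc _ _)))))
cover-count (true ∷ B)  (false ∷ C) h = s≤s (cover-count B C (h ∘ suc))
cover-count (false ∷ B) (true ∷ C)  h = ≤-trans (s≤s (cover-count B C (h ∘ suc))) (≤-reflexive (sym (+-suc _ _)))
cover-count (false ∷ B) (false ∷ C) h = case h zero of λ { (inj₁ ()) ; (inj₂ ()) }

half : ∀ {m τ} (B C : Vec Bool m) → τ + τ ≤ m → (∀ i → lookup B i ≡ true ⊎ lookup C i ≡ true) →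
       τ ≤ ∣ B ∣ ⊎ τ ≤ ∣ C ∣
half {m} {τ} B C 2τ≤m h with τ ≤? ∣ B ∣ | τ ≤? ∣ C ∣
... | yes p | _     = inj₁ p
... | no _  | yes q = inj₂ q
... | no p  | no q  = contradiction (≤-trans 2τ≤m (cover-count B C h)) (<⇒≱ (+-mono-< (≰⇒> p) (≰⇒> q)))

bits : ∀ m → Fin (2 ^ m) → Vec Bool m
bits zero    _ = []
bits (suc m) i = does (proj₁ (remQuot {2} (2 ^ m) i) ≟ zero) ∷ bits m (proj₂ (remQuot {2} (2 ^ m) i))

bits-injective : ∀ m {i j} → bits m i ≡ bits m j → i ≡ j
bits-injective zero    {zero} {zero} _ = refl
bits-injective (suc m) {i} {j} e = trans (sym (combine-remQuot {2} (2 ^ m) i))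
  (trans (cong₂ combine (bit (proj₁ (remQuot {2} (2 ^ m) i)) (proj₁ (remQuot {2} (2 ^ m) j))
                             (proj₁ (∷-injective e)))
                        (bits-injective m (proj₂ (∷-injective e))))
         (combine-remQuot {2} (2 ^ m) j))
  where
  bit : (x y : Fin 2) → does (x ≟ zero) ≡ does (y ≟ zero) → x ≡ y
  bit zero       zero       _ = refl
  bit (suc zero) (suc zero) _ = refl

search-Clique : ∀ {k} (e : CliqueExpr k) → Searchable (Vertex (evalClique e))
search-Clique (atom i)    = any?
search-Clique (η i j _ e) = search-Clique e
search-Clique (ρ i j e)   = search-Clique e
search-Clique (e ⊕ e′)    = search-⊎ (search-Clique e) (search-Clique e′)

-- From clique-width expressions to filtrations

module CliqueBound {a τ c : ℕ} (2τ≤a : τ + τ ≤ a) (few : ¬ 2 ^ τ ≤ c) (t : Term (suc (suc (suc a)))) where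

  private
    A : Fin a → V⁺ t
    A i = inj₁ (fixed i)

  Occurs : (e : CliqueExpr c) → (Vertex (evalClique e) → V⁺ t) → V⁺ t → Set
  Occurs e π w = ∃[ u ] π u ≡ w

  occurs? : ∀ e π w → Dec (Occurs e π w)
  occurs? e π w = search-Clique e λ u → ≟-V⁺ t (π u) w

  occurs : (e : CliqueExpr c) → (Vertex (evalClique e) → V⁺ t) → V t → Bool
  occurs e π v = does (occurs? e π (inj₂ v))

  occurs⇒ : ∀ e π {v} → occurs e π v ≡ true → Occurs e π (inj₂ v)
  occurs⇒ e π {v} x with occurs? e π (inj₂ v)
  ... | yes u = u

  occurs⇐ : ∀ e π {v} → Occurs e π (inj₂ v) → occurs e π v ≡ true
  occurs⇐ e π {v} u = dec-true (occurs? e π (inj₂ v)) u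

  Poor : (V t → Bool) → Set
  Poor X = ¬ Rich t X

  Thin : (V t → Bool) → Set
  Thin X = ∀ {m} → System t (Cut X) m → m ≤ c

  -- Since `z i` does not occur yet, the edge from `r i` to it comes later and reaches all vertices
  -- with the label of `r i`. Equal labels for `r i` and `r j` would thus create both adjacencies
  -- that `indep` forbids.
  thin-occurs : ∀ e π → FutureOf t (evalClique e) π → Thin (occurs e π)
  thin-occurs e π F s = distinct-labels (λ i → label H (u i)) λ {i} {j} i≢j q →
      indep s i≢j (near j i (sym q)) (near i j q)
    where
    H = evalClique e
    u : ∀ i → Vertex H
    u i = proj₁ (occurs⇒ e π (proj₁ (anchor s i)))
    over : ∀ i → π (u i) ≡ inj₂ (r s i)
    over i = proj₂ (occurs⇒ e π (proj₁ (anchor s i)))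
    near : ∀ i j → label H (u i) ≡ label H (u j) → adj t (r s j) (z s i) ≡ true
    near i j q with Future.later F {z = inj₂ (z s i)} q (subst (λ w → adj⁺ t w _ ≡ true) (sym (over i)) (edge s i))
    ... | inj₂ x = subst (λ w → adj⁺ t w _ ≡ true) (over j) x
    ... | inj₁ (_ , v , _ , qv , _) =
      contradiction (trans (sym (proj₂ (anchor s i))) (occurs⇐ e π (v , qv))) false≢true

  -- Edges to the missing hubs in `B` come later and respect labels. A rich set has a vertex for
  -- every subset of `B`, and vertices for different subsets need different labels.
  rich-bound : ∀ e π → FutureOf t (evalClique e) π → Rich t (occurs e π) →
               ∀ B → (∀ i → lookup B i ≡ true → ¬ Occurs e π (A i)) → 2 ^ ∣ B ∣ ≤ c
  rich-bound e π F rich B missing = distinct-labels (λ x → label H (u x)) λ {x} {y} x≢y q →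
      x≢y (bits-injective ∣ B ∣ (spread-injective B (bits _ x) (bits _ y) λ i b →
        iff (agree q b) (agree (sym q) b)))
    where
    H = evalClique e
    subset : Fin (2 ^ ∣ B ∣) → Vec Bool a
    subset x = spread B (bits ∣ B ∣ x)
    v : Fin (2 ^ ∣ B ∣) → V t
    v x = proj₁ (rich (subset x))
    u : Fin (2 ^ ∣ B ∣) → Vertex H
    u x = proj₁ (occurs⇒ e π (proj₁ (proj₂ (rich (subset x)))))
    over : ∀ x → π (u x) ≡ inj₂ (v x)
    over x = proj₂ (occurs⇒ e π (proj₁ (proj₂ (rich (subset x)))))
    trace : ∀ x i → adj⁺ t (π (u x)) (A i) ≡ lookup (subset x) i
    trace x i = trans (cong (λ w → adj⁺ t w (A i)) (over x)) (proj₂ (proj₂ (rich (subset x))) i)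
    agree : ∀ {x y i} → label H (u x) ≡ label H (u y) → lookup B i ≡ true →
            lookup (subset x) i ≡ true → lookup (subset y) i ≡ true
    agree {x} {y} {i} q b p with Future.later F {z = A i} q (trans (trace x i) p)
    ... | inj₁ (_ , w , _ , qw , _) = contradiction (w , qw) (missing i b)
    ... | inj₂ p′ = trans (sym (trace y i)) p′
    iff : ∀ {b b′ : Bool} → (b ≡ true → b′ ≡ true) → (b′ ≡ true → b ≡ true) → b ≡ b′
    iff {true}          f g = sym (f refl)
    iff {false} {false} f g = refl
    iff {false} {true}  f g = g refl

  absent : ∀ e π → Vec Bool a
  absent e π = tabulate λ i → not (does (occurs? e π (A i)))

  absent⇒ : ∀ e π i → lookup (absent e π) i ≡ true → ¬ Occurs e π (A i)
  absent⇒ e π i b with occurs? e π (A i) | trans (sym (lookup∘tabulate (λ i → not (does (occurs? e π (A i)))) i)) b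
  ... | no ¬o | _ = ¬o

  absent⇐ : ∀ e π i → ¬ Occurs e π (A i) → lookup (absent e π) i ≡ true
  absent⇐ e π i ¬o = trans (lookup∘tabulate _ i) (cong not (dec-false (occurs? e π (A i)) ¬o))

  not-rich : ∀ e π → FutureOf t (evalClique e) π → τ ≤ ∣ absent e π ∣ → Poor (occurs e π)
  not-rich e π F τ≤ rich = few (≤-trans (^-monoʳ-≤ 2 τ≤) (rich-bound e π F rich (absent e π) (absent⇒ e π)))

  -- A descent through the expression that drops a poor side at each union. The operations `η` and
  -- `ρ` contribute no step, as they do not change the vertex set.
  data Chain : (V t → Bool) → Set where
    stop : ∀ {X} → Thin X → Poor X → Chain X
    step : ∀ {X X′ Y} → Thin X → Poor Y → (∀ v → X′ v ≡ true → X v ≡ true) →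
           (∀ v → X v ≡ true → X′ v ≡ true ⊎ Y v ≡ true) → Chain X′ → Chain X

  -- Without fusion `π` stays injective, so no fixed hub occurs on both sides of a union. One side
  -- then lacks at least `τ` of the hubs and is poor.
  chain : ∀ e π → FutureOf t (evalClique e) π → (∀ {u v} → π u ≡ π v → u ≡ v) → Chain (occurs e π)
  chain (η i j i≢j e) π F inj = chain e π (future-join _ _ i≢j F) inj
  chain (ρ i j e)     π F inj = chain e π (future-relabel _ _ F) inj
  chain (atom i) π F inj = stop (thin-occurs (atom i) π F) poor
    where
    poor : Poor (occurs (atom i) π)
    poor rich with occurs⇒ (atom i) π (proj₁ (proj₂ (rich ∅)))
    -- Richness makes the single vertex of the atom a non-hub, so every fixed hub is absent.
    -- Applying `half` to this full set twice turns `2τ≤a` into the required bound on its size.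
    ... | zero , q = [ not-rich (atom i) π F , not-rich (atom i) π F ]′
        (half (absent (atom i) π) (absent (atom i) π) 2τ≤a λ j →
          inj₁ (absent⇐ (atom i) π j λ { (zero , q′) → case trans (sym q) q′ of λ () }))
        rich
  chain (e ⊕ e′) π F inj = decide (rich? t X₁) (rich? t X₂)
    where
    π₁ = π ∘ inj₁
    π₂ = π ∘ inj₂
    F₁ = future-unionˡ _ _ F
    F₂ = future-unionʳ _ _ F
    X₁ = occurs e π₁
    X₂ = occurs e′ π₂
    X = occurs (e ⊕ e′) π
    thin : Thin X
    thin = thin-occurs (e ⊕ e′) π F
    split : ∀ v → X v ≡ true → X₁ v ≡ true ⊎ X₂ v ≡ true
    split v x with occurs⇒ (e ⊕ e′) π x
    ... | inj₁ u , q = inj₁ (occurs⇐ e π₁ (u , q))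
    ... | inj₂ u , q = inj₂ (occurs⇐ e′ π₂ (u , q))
    left : ∀ v → X₁ v ≡ true → X v ≡ true
    left v x = let u , q = occurs⇒ e π₁ x in occurs⇐ (e ⊕ e′) π (inj₁ u , q)
    right : ∀ v → X₂ v ≡ true → X v ≡ true
    right v x = let u , q = occurs⇒ e′ π₂ x in occurs⇐ (e ⊕ e′) π (inj₂ u , q)
    cover : ∀ i → lookup (absent e π₁) i ≡ true ⊎ lookup (absent e′ π₂) i ≡ true
    cover i with occurs? e π₁ (A i) | occurs? e′ π₂ (A i)
    ... | yes (u , q) | yes (u′ , q′) = case inj (trans q (sym q′)) of λ ()
    ... | yes _ | no ¬o = inj₂ (absent⇐ e′ π₂ i ¬o)
    ... | no ¬o | _     = inj₁ (absent⇐ e π₁ i ¬o)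
    decide : Dec (Rich t X₁) → Dec (Rich t X₂) → Chain X
    decide (no poor) _ = step thin poor right (λ v → swap ∘ split v)
                              (chain e′ π₂ F₂ λ q → inj₂-injective (inj q))
    decide _ (no poor) = step thin poor left split (chain e π₁ F₁ λ q → inj₁-injective (inj q))
    decide (yes r₁) (yes r₂) with half (absent e π₁) (absent e′ π₂) 2τ≤a cover
    ... | inj₁ τ≤ = contradiction r₁ (not-rich e π₁ F₁ τ≤)
    ... | inj₂ τ≤ = contradiction r₂ (not-rich e′ π₂ F₂ τ≤)

  filtration : ∀ {X} → Chain X → (∀ v → X v ≡ true) → Filtration c t
  filtration {X} ch all = record
    { X = at ch ; top = all ; anti = anti ch ; split = split ch
    ; bottom = bottom ch ; thin = thin ch }
    where
    at : ∀ {X} → Chain X → ℕ → V t → Bool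
    at {X} _             zero    = X
    -- Past the end of the chain the last set, which is poor, is repeated forever; it also serves as
    -- the set `Y` in `split`.
    at {X} (stop _ _)    (suc n) = X
    at (step _ _ _ _ ch) (suc n) = at ch n
    anti : ∀ {X} (ch : Chain X) n {v} → at ch (suc n) v ≡ true → at ch n v ≡ true
    anti (stop _ _)        zero    x = x
    anti (stop _ _)        (suc n) x = x
    anti (step _ _ h _ ch) zero    x = h _ x
    anti (step _ _ _ _ ch) (suc n) x = anti ch n x
    split : ∀ {X} (ch : Chain X) n →
            ∃[ Y ] (Poor Y × (∀ v → at ch n v ≡ true → at ch (suc n) v ≡ true ⊎ Y v ≡ true))
    split (stop _ poor)        zero    = _ , poor , λ v → inj₁
    split (stop _ poor)        (suc n) = _ , poor , λ v → inj₁
    split (step _ poor _ h ch) zero    = _ , poor , h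
    split (step _ _ _ _ ch)    (suc n) = split ch n
    bottom : ∀ {X} (ch : Chain X) → ∃[ n ] Poor (at ch n)
    bottom (stop _ poor)     = 0 , poor
    bottom (step _ _ _ _ ch) = let n , p = bottom ch in suc n , p
    thin : ∀ {X} (ch : Chain X) n → Thin (at ch n)
    thin (stop h _)        zero    = h
    thin (stop h _)        (suc n) = h
    thin (step h _ _ _ ch) zero    = h
    thin (step _ _ _ _ ch) (suc n) = thin ch n

  generated-filtration : CliqueGenerated (graph t) c → Filtration c t
  generated-filtration (e , gen) = let π , F , onto , inj = future-generated t gen in
    filtration (chain e π F inj) λ v → occurs⇐ e π (onto (inj₂ v))

-- Fusion expressions for terms

-- A homomorphism of H onto the labelled graph (W, lab, E), injective on the
-- vertices whose labels satisfy Done.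
record Quotient {k} (H : LabelledGraph k) {W : Set} (lab : W → Fin k) (E : W → W → Set)
                (Done : Fin k → Set) : Set where
  field
    f      : Vertex H → W
    onto   : ∀ w → ∃[ v ] f v ≡ w
    label≡ : ∀ v → label H v ≡ lab (f v)
    edge⇒  : ∀ {u v} → Edge H u v → E (f u) (f v)
    edge⇐  : ∀ {a b} → E a b → ∃[ u ] ∃[ v ] (f u ≡ a × f v ≡ b × Edge H u v)
    inj    : ∀ {u v} → Done (label H u) → f u ≡ f v → u ≡ v

open Quotient

-- With this choice of `Done` a quotient is an isomorphism.
Every : ∀ {k} → Fin k → Set
Every _ = ⊤

q-atom : ∀ {k} {i : Fin k} {Done} → Quotient (isolated i 1) {⊤} (λ _ → i) (λ _ _ → ⊥) Done
q-atom = record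
  { f      = λ _ → tt
  ; onto   = λ { tt → zero , refl }
  ; label≡ = λ _ → refl
  ; edge⇒  = λ ()
  ; edge⇐  = λ ()
  ; inj    = λ { {zero} {zero} _ _ → refl }
  }

q-union : ∀ {k} {H K : LabelledGraph k} {W W′} {lab : W → _} {lab′ : W′ → _} {E E′ Done} →
          Quotient H lab E Done → Quotient K lab′ E′ Done →
          Quotient (union H K) [ lab , lab′ ]′ (Pointwise E E′) Done
q-union p q = record
  { f      = λ { (inj₁ v) → inj₁ (f p v) ; (inj₂ v) → inj₂ (f q v) }
  ; onto   = λ { (inj₁ w) → let v , e = onto p w in inj₁ v , cong inj₁ e
               ; (inj₂ w) → let v , e = onto q w in inj₂ v , cong inj₂ e }
  ; label≡ = λ { (inj₁ v) → label≡ p v ; (inj₂ v) → label≡ q v }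
  ; edge⇒  = λ { (inj₁ e) → inj₁ (edge⇒ p e) ; (inj₂ e) → inj₂ (edge⇒ q e) }
  ; edge⇐  = λ { (inj₁ e) → let u , v , eu , ev , e′ = edge⇐ p e
                            in inj₁ u , inj₁ v , cong inj₁ eu , cong inj₁ ev , inj₁ e′
               ; (inj₂ e) → let u , v , eu , ev , e′ = edge⇐ q e
                            in inj₂ u , inj₂ v , cong inj₂ eu , cong inj₂ ev , inj₂ e′ }
  ; inj    = λ { {inj₁ _} {inj₁ _} d e → cong inj₁ (inj p d (inj₁-injective e))
               ; {inj₂ _} {inj₂ _} d e → cong inj₂ (inj q d (inj₂-injective e)) }
  }

q-join : ∀ {k} {H : LabelledGraph k} {W} {lab : W → _} {E Done} i j → Quotient H lab E Done →
         Quotient (join i j H) lab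
           (λ a b → E a b ⊎ (lab a ≡ i × lab b ≡ j) ⊎ (lab a ≡ j × lab b ≡ i)) Done
q-join {H = H} {lab = lab} i j q = record
  { f      = f q
  ; onto   = onto q
  ; label≡ = label≡ q
  ; edge⇒  = λ { (inj₁ e) → inj₁ (edge⇒ q e)
               ; (inj₂ (inj₁ (a , b))) → inj₂ (inj₁ (down a , down b))
               ; (inj₂ (inj₂ (a , b))) → inj₂ (inj₂ (down a , down b)) }
  ; edge⇐  = λ { (inj₁ e) → let u , v , eu , ev , e′ = edge⇐ q e in u , v , eu , ev , inj₁ e′
               ; {a} {b} (inj₂ (inj₁ (la , lb))) →
                   let u , eu = onto q a ; v , ev = onto q b
                   in u , v , eu , ev , inj₂ (inj₁ (up eu la , up ev lb))
               ; {a} {b} (inj₂ (inj₂ (la , lb))) →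
                   let u , eu = onto q a ; v , ev = onto q b
                   in u , v , eu , ev , inj₂ (inj₂ (up eu la , up ev lb)) }
  ; inj    = inj q
  }
  where
  down : ∀ {u l} → label H u ≡ l → lab (f q u) ≡ l
  down e = trans (sym (label≡ q _)) e
  up : ∀ {u a l} → f q u ≡ a → lab a ≡ l → label H u ≡ l
  up refl e = trans (label≡ q _) e

q-relabel : ∀ {k} {H : LabelledGraph k} {W} {lab : W → _} {E} i j → Quotient H lab E Every →
            Quotient (relabel i j H) (λ w → if ⌊ lab w ≟ i ⌋ then j else lab w) E Every
q-relabel i j q = record
  { f      = f q
  ; onto   = onto q
  ; label≡ = λ v → cong (λ l → if ⌊ l ≟ i ⌋ then j else l) (label≡ q v)
  ; edge⇒  = edge⇒ q
  ; edge⇐  = edge⇐ q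
  ; inj    = inj q
  }

-- Composes with a further quotient map `g`, which may identify vertices whose labels `Done′` leaves
-- out.
q-map : ∀ {k} {H : LabelledGraph k} {W W′} {lab : W → _} {lab′ : W′ → _} {E E′ Done Done′}
        (g : W → W′) → (∀ w′ → ∃[ w ] g w ≡ w′) → (∀ w → lab w ≡ lab′ (g w)) →
        (∀ {a b} → E a b → E′ (g a) (g b)) →
        (∀ {a b} → E′ a b → ∃[ u ] ∃[ v ] (g u ≡ a × g v ≡ b × E u v)) →
        (∀ {a b} → Done′ (lab a) → g a ≡ g b → Done (lab a) × a ≡ b) →
        Quotient H lab E Done → Quotient H lab′ E′ Done′
q-map {Done = Done} {Done′} g g-onto g-label g⇒ g⇐ g-inj q = record
  { f      = g ∘ f q
  ; onto   = λ w′ → let w , e = g-onto w′ ; v , e′ = onto q w in v , trans (cong g e′) e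
  ; label≡ = λ v → trans (label≡ q v) (g-label _)
  ; edge⇒  = λ e → g⇒ (edge⇒ q e)
  ; edge⇐  = λ e → let a , b , ea , eb , e₁ = g⇐ e ; u , v , eu , ev , e₂ = edge⇐ q e₁
                   in u , v , trans (cong g eu) ea , trans (cong g ev) eb , e₂
  ; inj    = λ {u} d e → let d′ , e′ = g-inj (subst Done′ (label≡ q u) d) e
                         in inj q (subst Done (sym (label≡ q u)) d′) e′
  }

-- All vertices of label `i` lie over `w₀`, so fusing them makes `i` a done label. Fusion drops the
-- edges among them; these would map to a loop at `w₀`, which is excluded.
q-fuse : ∀ {k} {H : LabelledGraph k} {W} {lab : W → _} {E Done} i w₀ → lab w₀ ≡ i →
         (∀ w → lab w ≡ i → w ≡ w₀) → ¬ E w₀ w₀ →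
         Quotient H lab E Done → Quotient (fuse i H) lab E (λ l → l ≡ i ⊎ Done l)
q-fuse {H = H} {W} {lab} {E} {Done} i w₀ lab-w₀ only irr q = record
  { f      = f′
  ; onto   = onto′
  ; label≡ = λ { (kept v _) → label≡ q v ; (merged _) → sym lab-w₀ }
  ; edge⇒  = λ {u} {v} → edge⇒′ u v
  ; edge⇐  = edge⇐′
  ; inj    = λ {u} {v} → inj′ u v
  }
  where
  f′ : FusedVertex i H → W
  f′ (kept v _) = f q v
  f′ (merged _) = w₀

  f≡w₀ : ∀ {v} → label H v ≡ i → f q v ≡ w₀
  f≡w₀ e = only _ (trans (sym (label≡ q _)) e)

  fuse-vertex : (v : Vertex H) → Dec (label H v ≡ i) → FusedVertex i H
  fuse-vertex v (yes e) = merged (v , e)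
  fuse-vertex v (no ¬e) = kept v ¬e

  f′-fuse : ∀ v d → f′ (fuse-vertex v d) ≡ f q v
  f′-fuse v (yes e) = sym (f≡w₀ e)
  f′-fuse v (no ¬e) = refl

  onto′ : ∀ w → ∃[ v ] f′ v ≡ w
  onto′ w = let v , e = onto q w in fuse-vertex v (label H v ≟ i) , trans (f′-fuse v (label H v ≟ i)) e

  edge⇒′ : ∀ u v → FusedEdge i H u v → E (f′ u) (f′ v)
  edge⇒′ (kept u _) (kept v _) e           = edge⇒ q e
  edge⇒′ (kept u _) (merged _) (w , l , e) = subst (E _) (f≡w₀ l) (edge⇒ q e)
  edge⇒′ (merged _) (kept v _) (w , l , e) = subst (λ x → E x _) (f≡w₀ l) (edge⇒ q e)

  fuse-edge : ∀ {u v} d d′ → Edge H u v → FusedEdge i H (fuse-vertex u d) (fuse-vertex v d′)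
  fuse-edge (no _)  (no _)  e = e
  fuse-edge (no _)  (yes l) e = _ , l , e
  fuse-edge (yes l) (no _)  e = _ , l , e
  fuse-edge {u} {v} (yes l) (yes l′) e =
    ⊥-elim (irr (subst (λ x → E x w₀) (f≡w₀ l) (subst (E _) (f≡w₀ l′) (edge⇒ q e))))

  edge⇐′ : ∀ {a b} → E a b → ∃[ u ] ∃[ v ] (f′ u ≡ a × f′ v ≡ b × FusedEdge i H u v)
  edge⇐′ e = let u , v , eu , ev , e′ = edge⇐ q e
             in fuse-vertex u (label H u ≟ i) , fuse-vertex v (label H v ≟ i) ,
                trans (f′-fuse u (label H u ≟ i)) eu , trans (f′-fuse v (label H v ≟ i)) ev ,
                fuse-edge (label H u ≟ i) (label H v ≟ i) e′

  kept-cong : ∀ {u v} .{p : label H u ≢ i} .{p′ : label H v ≢ i} → u ≡ v →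
              kept {i = i} {H} u p ≡ kept v p′
  kept-cong refl = refl

  label≡i : ∀ {v} → f q v ≡ w₀ → label H v ≡ i
  label≡i e = trans (label≡ q _) (trans (cong lab e) lab-w₀)

  inj′ : ∀ u v → fusedLabel i H u ≡ i ⊎ Done (fusedLabel i H u) → f′ u ≡ f′ v → u ≡ v
  inj′ (kept u p) (kept v _) (inj₁ l) _ = Irrelevant.⊥-elim (p l)
  inj′ (kept u _) (kept v _) (inj₂ d) e = kept-cong (inj q d e)
  inj′ (kept u p) (merged _) _ e        = Irrelevant.⊥-elim (p (label≡i e))
  inj′ (merged _) (kept v p) _ e        = Irrelevant.⊥-elim (p (label≡i (sym e)))
  inj′ (merged _) (merged _) _ _        = refl

hubLabel : ∀ {j S} {A : Set} → (Fin j → Fin S) → Fin j ⊎ A → Fin (suc S)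
hubLabel g (inj₁ i) = suc (g i)
hubLabel g (inj₂ _) = zero

FusionQuotient : ∀ {k} → FusionExpr k → {W : Set} → (W → Fin k) → (W → W → Bool) → Set
FusionQuotient e lab E = Quotient (evalFusion e) lab (λ a b → E a b ≡ true) Every

Presentation : ∀ {S} → Term S → Set
Presentation {S} t = Σ (FusionExpr (suc S)) λ e → FusionQuotient e (hubLabel id) (adj⁺ t)

-- Hubs are added one at a time and joined to the leaf at once if the port asks for it. As `g` is
-- injective, the new hub is alone with its label, so `η` creates one edge only. The map `g` keeps
-- the slot names fixed while the induction varies the number `j` of hubs.
present-star : ∀ {j S} (g : Fin j → Fin S) → (∀ {a b} → g a ≡ g b → a ≡ b) → (p : Vec Bool j) →
               Σ (FusionExpr (suc S)) λ e →
               FusionQuotient e {Fin j ⊎ ⊤} (hubLabel g) (withHubs (λ _ → lookup p) (λ _ _ → false))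
present-star g g-inj [] = atom zero 1 , q-map inj₂ (λ { (inj₂ w) → w , refl }) (λ _ → refl) (λ ())
  (λ { {inj₂ _} {inj₂ _} () }) (λ { _ refl → tt , refl }) (q-atom {Done = Every})
present-star {suc j} {S} g g-inj (b ∷ p) = add b
  where
  e = proj₁ (present-star (g ∘ suc) (suc-injective ∘ g-inj) p)
  q = proj₂ (present-star (g ∘ suc) (suc-injective ∘ g-inj) p)
  step : Fin j ⊎ ⊤ → Fin (suc j) ⊎ ⊤
  step (inj₁ i) = inj₁ (suc i)
  step (inj₂ t) = inj₂ t
  place : (Fin j ⊎ ⊤) ⊎ ⊤ → Fin (suc j) ⊎ ⊤
  place (inj₁ w) = step w
  place (inj₂ _) = inj₁ zero
  place-onto : ∀ w → ∃[ v ] place v ≡ w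
  place-onto (inj₁ zero)    = inj₂ tt , refl
  place-onto (inj₁ (suc i)) = inj₁ (inj₁ i) , refl
  place-onto (inj₂ t)       = inj₁ (inj₂ t) , refl
  place-inj : ∀ {a b} → place a ≡ place b → a ≡ b
  place-inj {inj₁ (inj₁ _)} {inj₁ (inj₁ _)} refl = refl
  place-inj {inj₁ (inj₂ _)} {inj₁ (inj₂ _)} refl = refl
  place-inj {inj₂ _}        {inj₂ _}        refl = refl
  place-inj {inj₁ (inj₁ _)} {inj₁ (inj₂ _)} ()
  place-inj {inj₁ (inj₂ _)} {inj₁ (inj₁ _)} ()
  place-inj {inj₁ (inj₁ _)} {inj₂ _} ()
  place-inj {inj₁ (inj₂ _)} {inj₂ _} ()
  place-inj {inj₂ _} {inj₁ (inj₁ _)} ()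
  place-inj {inj₂ _} {inj₁ (inj₂ _)} ()
  E : Bool → Fin (suc j) ⊎ ⊤ → Fin (suc j) ⊎ ⊤ → Set
  E b u v = withHubs (λ _ → lookup (b ∷ p)) (λ _ _ → false) u v ≡ true
  E-sym : ∀ {b} u v → E b u v → E b v u
  E-sym {b} u v e = trans (withHubs-sym {p = λ _ → lookup (b ∷ p)} (λ _ _ → refl) v u) e
  E₀ : (Fin j ⊎ ⊤) ⊎ ⊤ → (Fin j ⊎ ⊤) ⊎ ⊤ → Set
  E₀ = Pointwise (λ u v → withHubs (λ _ → lookup p) (λ _ _ → false) u v ≡ true) (λ _ _ → ⊥)
  oldLabel : (Fin j ⊎ ⊤) ⊎ ⊤ → Fin (suc S)
  oldLabel = [ hubLabel (g ∘ suc) , (λ _ → suc (g zero)) ]′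
  E₀⇒ : ∀ {b u v} → E₀ u v → E b (place u) (place v)
  E₀⇒ (inj₁ {inj₁ _} {inj₂ _} x) = x
  E₀⇒ (inj₁ {inj₂ _} {inj₁ _} x) = x
  E₀⇒ (inj₁ {inj₁ _} {inj₁ _} ())
  E₀⇒ (inj₁ {inj₂ _} {inj₂ _} ())
  new⇒ : ∀ {u v} → oldLabel u ≡ zero → oldLabel v ≡ suc (g zero) → E true (place u) (place v)
  new⇒ {inj₁ (inj₂ _)} {inj₁ (inj₁ _)} _ e = case g-inj (suc-injective e) of λ ()
  new⇒ {inj₁ (inj₂ _)} {inj₂ _}        _ _ = refl
  place-label : ∀ w → oldLabel w ≡ hubLabel g (place w)
  place-label (inj₁ (inj₁ _)) = refl
  place-label (inj₁ (inj₂ _)) = refl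
  place-label (inj₂ _)        = refl
  E⇐-false : ∀ {a b} → E false a b → ∃[ u ] ∃[ v ] (place u ≡ a × place v ≡ b × E₀ u v)
  E⇐-false {inj₁ (suc _)} {inj₂ _} x = _ , _ , refl , refl , inj₁ x
  E⇐-false {inj₂ _} {inj₁ (suc _)} x = _ , _ , refl , refl , inj₁ x
  E₁ : (Fin j ⊎ ⊤) ⊎ ⊤ → (Fin j ⊎ ⊤) ⊎ ⊤ → Set
  E₁ u v = E₀ u v ⊎ (oldLabel u ≡ zero × oldLabel v ≡ suc (g zero))
                  ⊎ (oldLabel u ≡ suc (g zero) × oldLabel v ≡ zero)
  E₁⇒ : ∀ {u v} → E₁ u v → E true (place u) (place v)
  E₁⇒ (inj₁ x) = E₀⇒ x
  E₁⇒ {u} {v} (inj₂ (inj₁ (l , l′))) = new⇒ {u} {v} l l′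
  E₁⇒ {u} {v} (inj₂ (inj₂ (l , l′))) = E-sym (place v) (place u) (new⇒ {v} {u} l′ l)
  E⇐-true : ∀ {a b} → E true a b → ∃[ u ] ∃[ v ] (place u ≡ a × place v ≡ b × E₁ u v)
  E⇐-true {inj₁ (suc _)} {inj₂ _} x = _ , _ , refl , refl , inj₁ (inj₁ x)
  E⇐-true {inj₂ _} {inj₁ (suc _)} x = _ , _ , refl , refl , inj₁ (inj₁ x)
  E⇐-true {inj₁ zero} {inj₂ _} _ = inj₂ _ , inj₁ (inj₂ _) , refl , refl , inj₂ (inj₂ (refl , refl))
  E⇐-true {inj₂ _} {inj₁ zero} _ = inj₁ (inj₂ _) , inj₂ _ , refl , refl , inj₂ (inj₁ (refl , refl))
  add : ∀ b → Σ (FusionExpr (suc S)) λ e → Quotient (evalFusion e) (hubLabel g) (E b) Every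
  add false = e ⊕ atom (suc (g zero)) 1 ,
    q-map place place-onto place-label E₀⇒ E⇐-false (λ _ e → tt , place-inj e) (q-union q q-atom)
  add true = η zero (suc (g zero)) (λ ()) (e ⊕ atom (suc (g zero)) 1) ,
    q-map place place-onto place-label E₁⇒ E⇐-true (λ _ e → tt , place-inj e)
      (q-join zero (suc (g zero)) (q-union q q-atom))

fuseHubs : ∀ {S} → List (Fin S) → FusionExpr (suc S) → FusionExpr (suc S)
fuseHubs is e = foldr (θ ∘ suc) e is

q-fuseHubs : ∀ {S} {e : FusionExpr (suc S)} {A : Set} {E : Fin S ⊎ A → Fin S ⊎ A → Set} {Done} is →
             (∀ {w} → ¬ E w w) → Quotient (evalFusion e) (hubLabel id) E Done →
             Quotient (evalFusion (fuseHubs is e)) (hubLabel id) E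
               (λ l → (∃[ i ] (i ∈ is × l ≡ suc i)) ⊎ Done l)
q-fuseHubs [] irr q = record
  { f = f q ; onto = onto q ; label≡ = label≡ q ; edge⇒ = edge⇒ q ; edge⇐ = edge⇐ q
  ; inj = λ { (inj₂ d) → inj q d } }
q-fuseHubs (i ∷ is) irr q = record
  { f = f q′ ; onto = onto q′ ; label≡ = label≡ q′ ; edge⇒ = λ {u} {v} → edge⇒ q′ {u} {v} ; edge⇐ = edge⇐ q′
  ; inj = λ { (inj₁ (_ , here refl , l)) → inj q′ (inj₁ l)
            ; (inj₁ (j , there j∈ , l)) → inj q′ (inj₂ (inj₁ (j , j∈ , l)))
            ; (inj₂ d) → inj q′ (inj₂ (inj₂ d)) } }
  where
  q′ = q-fuse (suc i) (inj₁ i) refl (λ { (inj₁ _) refl → refl }) irr (q-fuseHubs is irr q)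

-- Each side brings a hub for every slot, so `glue` is injective on finished vertices only; fusing
-- every hub label repairs this.
present-∥ : ∀ {S} {s t : Term S} → Presentation s → Presentation t → Presentation (s ∥ t)
present-∥ {S} {s} {t} (e , p) (e′ , q) = fuseHubs (allFin S) (e ⊕ e′) ,
  q-map id (λ w → w , refl) (λ _ → refl) id (λ x → _ , _ , refl , refl , x)
    (λ {a} _ eq → every-label a , eq)
    (q-fuseHubs {e = e ⊕ e′} {Done = _≡ zero} (allFin S)
      (λ {w} x → false≢true (trans (sym (adj⁺-irrefl (s ∥ t) w)) x))
      (q-map glue glue-onto glue-label glue⇒ glue⇐ glue-inj (q-union p q)))
  where
  every-label : (w : V⁺ (s ∥ t)) →
                (∃[ i ] (i ∈ allFin S × hubLabel id w ≡ suc i)) ⊎ hubLabel id w ≡ zero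
  every-label (inj₁ i) = inj₁ (i , ∈-allFin i , refl)
  every-label (inj₂ _) = inj₂ refl
  glue : V⁺ s ⊎ V⁺ t → V⁺ (s ∥ t)
  glue (inj₁ (inj₁ i)) = inj₁ i
  glue (inj₁ (inj₂ v)) = inj₂ (inj₁ v)
  glue (inj₂ (inj₁ i)) = inj₁ i
  glue (inj₂ (inj₂ v)) = inj₂ (inj₂ v)
  glue-onto : ∀ w → ∃[ v ] glue v ≡ w
  glue-onto (inj₁ i)        = inj₁ (inj₁ i) , refl
  glue-onto (inj₂ (inj₁ v)) = inj₁ (inj₂ v) , refl
  glue-onto (inj₂ (inj₂ v)) = inj₂ (inj₂ v) , refl
  lab : V⁺ s ⊎ V⁺ t → Fin (suc S)
  lab = [ hubLabel id , hubLabel id ]′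
  glue-label : ∀ w → lab w ≡ hubLabel id (glue w)
  glue-label (inj₁ (inj₁ i)) = refl
  glue-label (inj₁ (inj₂ v)) = refl
  glue-label (inj₂ (inj₁ i)) = refl
  glue-label (inj₂ (inj₂ v)) = refl
  E : V⁺ s ⊎ V⁺ t → V⁺ s ⊎ V⁺ t → Set
  E = Pointwise (λ a b → adj⁺ s a b ≡ true) (λ a b → adj⁺ t a b ≡ true)
  glue⇒ : ∀ {a b} → E a b → adj⁺ (s ∥ t) (glue a) (glue b) ≡ true
  glue⇒ (inj₁ {inj₁ _} {inj₂ _} e) = e
  glue⇒ (inj₁ {inj₂ _} {inj₁ _} e) = e
  glue⇒ (inj₁ {inj₂ _} {inj₂ _} e) = e
  glue⇒ (inj₂ {inj₁ _} {inj₂ _} e) = e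
  glue⇒ (inj₂ {inj₂ _} {inj₁ _} e) = e
  glue⇒ (inj₂ {inj₂ _} {inj₂ _} e) = e
  glue⇐ : ∀ {a b} → adj⁺ (s ∥ t) a b ≡ true → ∃[ u ] ∃[ v ] (glue u ≡ a × glue v ≡ b × E u v)
  glue⇐ {inj₁ _} {inj₂ (inj₁ _)} e = inj₁ (inj₁ _) , inj₁ (inj₂ _) , refl , refl , inj₁ e
  glue⇐ {inj₁ _} {inj₂ (inj₂ _)} e = inj₂ (inj₁ _) , inj₂ (inj₂ _) , refl , refl , inj₂ e
  glue⇐ {inj₂ (inj₁ _)} {inj₁ _} e = inj₁ (inj₂ _) , inj₁ (inj₁ _) , refl , refl , inj₁ e
  glue⇐ {inj₂ (inj₂ _)} {inj₁ _} e = inj₂ (inj₂ _) , inj₂ (inj₁ _) , refl , refl , inj₂ e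
  glue⇐ {inj₂ (inj₁ _)} {inj₂ (inj₁ _)} e = inj₁ (inj₂ _) , inj₁ (inj₂ _) , refl , refl , inj₁ e
  glue⇐ {inj₂ (inj₂ _)} {inj₂ (inj₂ _)} e = inj₂ (inj₂ _) , inj₂ (inj₂ _) , refl , refl , inj₂ e
  glue-inj : ∀ {a b} → lab a ≡ zero → glue a ≡ glue b → ⊤ × a ≡ b
  glue-inj {inj₁ (inj₂ _)} {inj₁ (inj₂ _)} _ refl = tt , refl
  glue-inj {inj₂ (inj₂ _)} {inj₂ (inj₂ _)} _ refl = tt , refl
  glue-inj {inj₁ (inj₂ _)} {inj₁ (inj₁ _)} _ ()
  glue-inj {inj₁ (inj₂ _)} {inj₂ (inj₁ _)} _ ()
  glue-inj {inj₁ (inj₂ _)} {inj₂ (inj₂ _)} _ ()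
  glue-inj {inj₂ (inj₂ _)} {inj₂ (inj₁ _)} _ ()
  glue-inj {inj₂ (inj₂ _)} {inj₁ (inj₁ _)} _ ()
  glue-inj {inj₂ (inj₂ _)} {inj₁ (inj₂ _)} _ ()

-- Relabelling to `zero` finishes the hub of `σ`; a fresh isolated hub keeps the slot occupied.
present-close : ∀ {S} {t : Term S} σ → Presentation t → Presentation (close σ t)
present-close {S} {t} σ (e , q) = ρ (suc σ) zero e ⊕ atom (suc σ) 1 ,
  q-map shift shift-onto shift-label shift⇒ shift⇐ (λ _ eq → tt , shift-inj eq)
    (q-union (q-relabel (suc σ) zero q) q-atom)
  where
  shift : V⁺ t ⊎ ⊤ → V⁺ (close σ t)
  shift (inj₁ (inj₁ i)) with i ≟ σ
  ... | yes _ = inj₂ hub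
  ... | no _  = inj₁ i
  shift (inj₁ (inj₂ v)) = inj₂ (old v)
  shift (inj₂ tt)       = inj₁ σ
  shift-σ : shift (inj₁ (inj₁ σ)) ≡ inj₂ hub
  shift-σ with σ ≟ σ
  ... | yes _  = refl
  ... | no σ≢σ = contradiction refl σ≢σ
  shift-other : ∀ {i} → i ≢ σ → shift (inj₁ (inj₁ i)) ≡ inj₁ i
  shift-other {i} i≢σ with i ≟ σ
  ... | yes i≡σ = contradiction i≡σ i≢σ
  ... | no _    = refl
  shift-onto : ∀ w → ∃[ v ] shift v ≡ w
  shift-onto (inj₁ i) with i ≟ σ
  ... | yes refl = inj₂ tt , refl
  ... | no i≢σ   = inj₁ (inj₁ i) , shift-other i≢σ
  shift-onto (inj₂ hub)     = inj₁ (inj₁ σ) , shift-σ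
  shift-onto (inj₂ (old v)) = inj₁ (inj₂ v) , refl
  lab : V⁺ t ⊎ ⊤ → Fin (suc S)
  lab = [ (λ w → if ⌊ hubLabel id w ≟ suc σ ⌋ then zero else hubLabel id w) , (λ _ → suc σ) ]′
  shift-label : ∀ w → lab w ≡ hubLabel id (shift w)
  shift-label (inj₁ (inj₁ i)) with i ≟ σ
  ... | yes _ = refl
  ... | no _  = refl
  shift-label (inj₁ (inj₂ v)) = refl
  shift-label (inj₂ tt)       = refl
  E : V⁺ t ⊎ ⊤ → V⁺ t ⊎ ⊤ → Set
  E = Pointwise (λ a b → adj⁺ t a b ≡ true) (λ _ _ → ⊥)
  shift⇒-hub : ∀ {i v} → port t v i ≡ true → adj⁺ (close σ t) (shift (inj₁ (inj₁ i))) (inj₂ (old v)) ≡ true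
  shift⇒-hub {i} {v} e with i ≟ σ
  ... | yes refl = e
  ... | no i≢σ   = trans (port-other σ t v i≢σ) e
  shift⇒ : ∀ {a b} → E a b → adj⁺ (close σ t) (shift a) (shift b) ≡ true
  shift⇒ (inj₁ {inj₁ i} {inj₂ v} e) = shift⇒-hub e
  shift⇒ (inj₁ {inj₂ v} {inj₁ i} e) =
    trans (adj⁺-sym (close σ t) (inj₂ (old v)) (shift (inj₁ (inj₁ i)))) (shift⇒-hub e)
  shift⇒ (inj₁ {inj₂ _} {inj₂ _} e) = e
  open-port : ∀ {i v} → port (close σ t) (old v) i ≡ true → i ≢ σ × port t v i ≡ true
  open-port {i} {v} e with i ≟ σ
  open-port () | yes _
  open-port e  | no i≢σ = i≢σ , e
  shift⇐ : ∀ {a b} → adj⁺ (close σ t) a b ≡ true → ∃[ u ] ∃[ v ] (shift u ≡ a × shift v ≡ b × E u v)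
  shift⇐ {inj₁ i} {inj₂ (old v)} e = let i≢σ , e′ = open-port {i} {v} e
    in inj₁ (inj₁ i) , inj₁ (inj₂ v) , shift-other i≢σ , refl , inj₁ e′
  shift⇐ {inj₂ (old v)} {inj₁ i} e = let i≢σ , e′ = open-port {i} {v} e
    in inj₁ (inj₂ v) , inj₁ (inj₁ i) , refl , shift-other i≢σ , inj₁ e′
  shift⇐ {inj₂ hub} {inj₂ (old v)} e = inj₁ (inj₁ σ) , inj₁ (inj₂ v) , shift-σ , refl , inj₁ e
  shift⇐ {inj₂ (old v)} {inj₂ hub} e = inj₁ (inj₂ v) , inj₁ (inj₁ σ) , refl , shift-σ , inj₁ e
  shift⇐ {inj₂ (old u)} {inj₂ (old v)} e = inj₁ (inj₂ u) , inj₁ (inj₂ v) , refl , refl , inj₁ e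
  unshift : V⁺ (close σ t) → V⁺ t ⊎ ⊤
  unshift (inj₁ i) with i ≟ σ
  ... | yes _ = inj₂ tt
  ... | no _  = inj₁ (inj₁ i)
  unshift (inj₂ hub)     = inj₁ (inj₁ σ)
  unshift (inj₂ (old v)) = inj₁ (inj₂ v)
  unshift-shift : ∀ a → unshift (shift a) ≡ a
  unshift-shift (inj₁ (inj₁ i)) with i ≟ σ in eq
  ... | yes refl = refl
  ... | no _ rewrite eq = refl
  unshift-shift (inj₁ (inj₂ v)) = refl
  unshift-shift (inj₂ tt) with σ ≟ σ
  ... | yes _  = refl
  ... | no σ≢σ = contradiction refl σ≢σ
  shift-inj : ∀ {a b} → shift a ≡ shift b → a ≡ b
  shift-inj {a} {b} eq = trans (sym (unshift-shift a)) (trans (cong unshift eq) (unshift-shift b))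

present-leaf : ∀ {S} (p : Vec Bool S) → Presentation (leaf p)
present-leaf p = let e , q = present-star id id p
  in e , q-map id (λ w → w , refl) (λ { (inj₁ _) → refl ; (inj₂ _) → refl }) (λ {a} {b} → star⇒ {a} {b})
       (λ {a} {b} x → _ , _ , refl , refl , star⇐ {a} {b} x) (λ _ eq → tt , eq) q
  where
  star = withHubs {A = ⊤} (λ _ → lookup p) (λ _ _ → false)
  same : ∀ a b → star a b ≡ adj⁺ (leaf p) a b
  same (inj₁ _) (inj₁ _) = refl
  same (inj₁ _) (inj₂ _) = refl
  same (inj₂ _) (inj₁ _) = refl
  same (inj₂ _) (inj₂ _) = refl
  star⇒ : ∀ {a b} → star a b ≡ true → adj⁺ (leaf p) a b ≡ true
  star⇒ {a} {b} x = trans (sym (same a b)) x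
  star⇐ : ∀ {a b} → adj⁺ (leaf p) a b ≡ true → star a b ≡ true
  star⇐ {a} {b} x = trans (same a b) x

present : ∀ {S} (t : Term S) → Presentation t
present (leaf p)    = present-leaf p
present (s ∥ t)     = present-∥ (present s) (present t)
present (close σ t) = present-close σ (present t)

fusion-generated : ∀ {S} (t : Term S) → FusionGenerated (graph t) (suc S)
fusion-generated t = let e , q = present t in e , generates q
  where
  open Inverse (V⁺↔Fin t) using () renaming
    (to to code; from to decode; strictlyInverseˡ to code-decode; strictlyInverseʳ to decode-code)
  generates : ∀ {k} {H : LabelledGraph k} {lab} → Quotient H lab (λ a b → adj⁺ t a b ≡ true) Every →
              H Generates (graph t)
  generates {H = H} q = mk↔ₛ′ (code ∘ f q) (λ x → proj₁ (onto q (decode x)))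
      (λ x → trans (cong code (proj₂ (onto q (decode x)))) (code-decode x))
      (λ v → inj q tt (trans (proj₂ (onto q _)) (decode-code (f q v)))) ,
    λ u v → mk⇔
      (λ e → trans (decode-adj u v) (edge⇒ q e))
      (λ e → let u′ , v′ , eu , ev , e′ = edge⇐ q (trans (sym (decode-adj u v)) e)
             in subst (λ u → Edge H u v) (inj q tt eu) (subst (Edge H u′) (inj q tt ev) e′))
    where
    decode-adj : ∀ u v → adj⁺ t (decode (code (f q u))) (decode (code (f q v))) ≡ adj⁺ t (f q u) (f q v)
    decode-adj u v = cong₂ (adj⁺ t) (decode-code (f q u)) (decode-code (f q v))

-- The two bounds together

fusion-label : ∀ {k} → FusionExpr k → Fin k
fusion-label (atom i _)  = i
fusion-label (η i _ _ _) = i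
fusion-label (ρ i _ _)   = i
fusion-label (θ i _)     = i
fusion-label (e ⊕ _)     = fusion-label e

clique-label : ∀ {k} → CliqueExpr k → Fin k
clique-label (atom i)    = i
clique-label (η i _ _ _) = i
clique-label (ρ i _ _)   = i
clique-label (e ⊕ _)     = clique-label e

positive : ∀ {k} → Fin k → 1 ≤ k
positive zero    = s≤s z≤n
positive (suc _) = s≤s z≤n

-- The bounds meet because the tree uses every slot: `zero` for the centres of the stars and each
-- other slot for one level.
nest-fusion-width : ∀ {n} (t : Term (suc n)) → nest (allFin n) ↪ t → HasFusionWidth (graph t) (suc (suc n))
nest-fusion-width {n} t ι = fusion-generated t , λ m gen →
  subst (λ x → suc (suc x) ≤ m) (length-tabulate {n = n} id)
    (FusionBound.fusion-bound t (allFin n) (allFin⁺ n) ι gen)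

-- Serves `k` up to 3, where the claimed bound on clique-width is at most 1 and any expression has a
-- label.
clique-width-positive : ∀ G {b} → b ≤ 4 → CliqueWidth G · (2 ^ 2) ≥ b
clique-width-positive G b≤4 c (e , _) = ≤-trans b≤4 (*-monoˡ-≤ 4 (positive (clique-label e)))

module _ (a : ℕ) where

  private
    τ N : ℕ
    τ = ⌊ a /2⌋
    N = 2 ^ τ

  -- The spine forces the clique-width and the nest the fusion-width. For the spine, one slot serves
  -- the star centres, two serve the spine hubs, and `a` are fixed.
  witness : Term (suc (suc (suc a)))
  witness = spine {a} N N zero (suc zero) ∥ nest (allFin (suc (suc a)))

  witness-clique-width : ∀ c → CliqueGenerated (graph witness) c → N ≤ c
  witness-clique-width c gen with N ≤? c
  ... | yes N≤c = N≤c
  ... | no N≰c = contradiction (≤-trans (n≤1+n N) (Filtration.thin F (proj₁ rows) (proj₂ rows))) N≰c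
    where
    τ+τ≤a : τ + τ ≤ a
    τ+τ≤a = ≤-trans (+-monoʳ-≤ τ (⌊n/2⌋≤⌈n/2⌉ a)) (≤-reflexive (⌊n/2⌋+⌈n/2⌉≡n a))
    F : Filtration c (spine {a} N N zero (suc zero))
    F = pull inˡ (λ _ _ → refl) (CliqueBound.generated-filtration {τ = τ} τ+τ≤a N≰c witness gen)
    -- Height `N` yields `suc N` independent cut edges at one time, more than `thin` permits when
    -- `c` is below `N`.
    rows = claim N (N≰c ∘ ≤-trans (n≤1+n N)) N (λ _ ()) (λ _ ()) (λ ()) F

corollary4 : (k : ℕ) → 1 ≤ k →
    ∃[ G ] (HasFusionWidth G k × CliqueWidth G · (2 ^ 2) ≥ (2 ^ ⌊ k /2⌋))
corollary4 1 _ = graph (leaf []) ,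
  (fusion-generated (leaf []) , λ m (e , _) → positive (fusion-label e)) ,
  clique-width-positive (graph (leaf [])) (s≤s z≤n)
corollary4 2 _ = let t = nest (allFin 0) in
  graph t , nest-fusion-width t ↪-refl , clique-width-positive (graph t) (s≤s (s≤s z≤n))
corollary4 3 _ = let t = nest (allFin 1) in
  graph t , nest-fusion-width t ↪-refl , clique-width-positive (graph t) (s≤s (s≤s z≤n))
-- Here `k` is `a + 4`, one more than the number of slots, and halving it gives `⌊ a /2⌋ + 2`; the
-- extra factor 4 cancels the denominator.
corollary4 (suc (suc (suc (suc a)))) _ = graph (witness a) ,
  nest-fusion-width (witness a) inʳ ,
  λ c gen → ≤-trans
    (≤-reflexive (trans (sym (*-assoc 2 2 (2 ^ ⌊ a /2⌋))) (*-comm 4 (2 ^ ⌊ a /2⌋))))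
    (*-monoˡ-≤ 4 (witness-clique-width a c gen))
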